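{- Let $A,B$ be unit-free MALL formulas and $\theta,\theta'$ cut-free proof-nets with conclusions $A^\perp,B$ and $B^\perp,A$ respectively, such that the composition of $\theta$ and $\theta'$ over $B$ reduces by cut-elimination to the identity proof-net of $A$ and the composition of $\theta'$ and $\theta$ over $A$ reduces to the identity proof-net of $B$. Then $\theta$ and $\theta'$ are bipartite and full.
   Context: Unit-free MALL formulas $A::=X\mid X^\perp\mid A\otimes A\mid A⅋A\mid A\&A\mid A\oplus A$, $(A\otimes B)^\perp=B^\perp⅋A^\perp$, $(A\&B)^\perp=B^\perp\oplus A^\perp$. Proof-nets (Hughes–van Glabbeek): a cut sequent $[\Sigma]\Gamma$ is a list $\Sigma$ of cut pairs $A*A^\perp$ and a sequent $\Gamma$, seen as a forest of syntactic trees with atom occurrences as leaves. Additive resolution: delete zero or more cut pairs and one argument subtree of each $\&$/$\oplus$; $\&$-resolution: delete one argument of each $\&$. Link: pair of leaves labelled $X$, $X^\perp$. Linking: set of disjoint links whose leaves are exactly the leaves of an additive resolution. $\Lambda$ toggles $\&$-vertex $W$ if both premises of $W$ occur in the union of the resolutions of $\Lambda$; link $a$ depends on $W$ in $\Lambda$ if $a\in\lambda\setminus\lambda'$ for some $\lambda,\lambda'\in\Lambda$ with $W$ the only $\&$ toggled by $\{\lambda,\lambda'\}$. $\mathcal{G}_\Lambda$: union of the resolutions, the links, and jump edges $l\to W$ for leaves $l$ of links depending on $W$. Switching cycle: cycle using at most one in-edge (premise edge or jump) of each $⅋$/$\&$ vertex; $⅋$-switching of $\lambda$: delete one premise edge of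 each $⅋$. A proof-net is a set $\theta$ of linkings with (P0) each cut pair has a leaf in some linking, (P1) exactly one linking on each $\&$-resolution, (P2) each $⅋$-switching of each linking is a tree, (P3) each $\Lambda\subseteq\theta$ of size $\ge2$ toggles a $\&$ in no switching cycle of $\mathcal{G}_\Lambda$. Cut-free: $\Sigma=\emptyset$; conclusions $\Gamma$. Composition over $A$ of $\theta$ (conclusions $\Gamma,A$) and $\psi$ (conclusions $\Delta,A^\perp$): all unions $\lambda\cup\mu$, on $[A*A^\perp]\Gamma,\Delta$. Cut-elimination steps: atomic cut: merge links $(l,A),(A^\perp,m)$ into $(l,m)$; $\otimes/⅋$ cut: split into the two subformula cuts; $\&/\oplus$ cut: split, delete linkings choosing non-dual premises, garbage-collect unused cut pairs. Identity proof-net of $A$: translation of the fully axiom-expanded axiom proof of $\vdash A^\perp,A$ (atomic axiom $\mapsto\{\{(X,X^\perp)\}\}$; $⅋,\oplus_i$ keep the set; $\otimes$ takes pairwise unions; $\&$ takes union of sets). A cut-free proof-net with two conclusions $A^\perp,B$ is bipartite if every link joins a leaf of $A^\perp$ and a leaf of $B$; it is full if every leaf belongs to at least one link of some linking. -}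

module Defs where

-- Hughes–van Glabbeek proof-nets for unit-free MALL, with cut-elimination.
-- Everything is first-order: vertices of the forest of a cut sequent are
-- concrete addresses, links are pairs of addresses, a linking is a finite
-- set of links (a list, read up to set equality), a net is a finite set of
-- linkings (a list of lists, read up to set equality).

open import Data.Nat using (ℕ; zero; suc; _+_; _∸_; _<_; _≡ᵇ_; _<ᵇ_)
open import Data.Bool using (Bool; true; false; _∧_; _∨_; not; if_then_else_)
open import Data.List using (List; []; _∷_; _++_; map; concatMap; filterᵇ; length)
open import Data.Bool.ListAction using (any)
open import Data.List.Membership.Propositional using (_∈_; _∉_)
open import Data.List.Relation.Unary.All using (All)
open import Data.List.Relation.Unary.Unique.Propositional using (Unique)
open import Data.Maybe using (Maybe; just; nothing; _>>=_)
import Data.Maybe as Maybe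
open import Data.Product using (Σ; _×_; _,_; proj₁; proj₂; Σ-syntax)
open import Data.Sum using (_⊎_)
open import Data.Empty using (⊥)
open import Relation.Nullary using (¬_)
open import Relation.Binary.PropositionalEquality using (_≡_)
open import Relation.Binary.Construct.Closure.ReflexiveTransitive using (Star)

data Fm : Set where
  pos neg : ℕ → Fm
  _⊗_ _⅋_ _&_ _⊕_ : Fm → Fm → Fm

dual : Fm → Fm
dual (pos x) = neg x
dual (neg x) = pos x
dual (A ⊗ B) = dual B ⅋ dual A
dual (A ⅋ B) = dual B ⊗ dual A
dual (A & B) = dual B ⊕ dual A
dual (A ⊕ B) = dual B & dual A

data Dir : Set where
  L R : Dir

-- paths from the root of a syntactic tree (root first); L = first argument
Path : Set
Path = List Dir

pick : Dir → Fm → Fm → Maybe Fm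
pick L A B = just A
pick R A B = just B

sub : Fm → Path → Maybe Fm
sub A [] = just A
sub (pos x) (_ ∷ _) = nothing
sub (neg x) (_ ∷ _) = nothing
sub (A ⊗ B) (d ∷ p) = pick d A B >>= λ C → sub C p
sub (A ⅋ B) (d ∷ p) = pick d A B >>= λ C → sub C p
sub (A & B) (d ∷ p) = pick d A B >>= λ C → sub C p
sub (A ⊕ B) (d ∷ p) = pick d A B >>= λ C → sub C p

-- cuts = the list of cut formulas A, the i-th cut pair being A * A^⊥
record Seq : Set where
  constructor seq
  field
    cuts  : List Fm
    concl : List Fm
open Seq public

cutFree : List Fm → Seq
cutFree Γ = seq [] Γ

-- vertices of the forest:
--   cv i   : the cut vertex * of the i-th cut pair (premises A and A^⊥)
--   cl i p : vertex at path p inside A of the i-th cut pair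
--   cr i p : vertex at path p inside A^⊥ of the i-th cut pair
--   gv j p : vertex at path p inside the j-th conclusion
data Addr : Set where
  cv : ℕ → Addr
  cl cr gv : ℕ → Path → Addr

nth : ∀ {a} {X : Set a} → List X → ℕ → Maybe X
nth [] _ = nothing
nth (x ∷ xs) zero = just x
nth (x ∷ xs) (suc n) = nth xs n

data Kind : Set where
  star : Kind
  fm   : Fm → Kind

lab : Seq → Addr → Maybe Kind
lab S (cv i)   = Maybe.map (λ _ → star) (nth (cuts S) i)
lab S (cl i p) = nth (cuts S) i >>= λ C → Maybe.map fm (sub C p)
lab S (cr i p) = nth (cuts S) i >>= λ C → Maybe.map fm (sub (dual C) p)
lab S (gv j p) = nth (concl S) j >>= λ C → Maybe.map fm (sub C p)

child : Addr → Dir → Addr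
child (cv i) L = cl i []
child (cv i) R = cr i []
child (cl i p) d = cl i (p ++ d ∷ [])
child (cr i p) d = cr i (p ++ d ∷ [])
child (gv j p) d = gv j (p ++ d ∷ [])

data _≼_ : Addr → Addr → Set where
  ≼-refl  : ∀ {a} → a ≼ a
  ≼-child : ∀ {a b d} → a ≼ b → a ≼ child b d

Valid : Seq → Addr → Set
Valid S a = Σ Kind λ k → lab S a ≡ just k

IsLeaf : Seq → Addr → Set
IsLeaf S a = Σ ℕ λ x → (lab S a ≡ just (fm (pos x))) ⊎ (lab S a ≡ just (fm (neg x)))

IsPar IsWith IsPlus : Seq → Addr → Set
IsPar  S u = Σ Fm λ X → Σ Fm λ Y → lab S u ≡ just (fm (X ⅋ Y))
IsWith S u = Σ Fm λ X → Σ Fm λ Y → lab S u ≡ just (fm (X & Y))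
IsPlus S u = Σ Fm λ X → Σ Fm λ Y → lab S u ≡ just (fm (X ⊕ Y))

InCut : ℕ → Addr → Set
InCut i (cv k)   = k ≡ i
InCut i (cl k _) = k ≡ i
InCut i (cr k _) = k ≡ i
InCut i (gv _ _) = ⊥

-- additive resolution: keep = which cut pairs are kept, c = which argument
-- of each &/⊕ vertex is kept; vertex set of the resolution:
InAddRes : Seq → (ℕ → Bool) → (Addr → Dir) → Addr → Set
InAddRes S keep c v =
  Valid S v × (∀ i → InCut i v → keep i ≡ true)
  × (∀ u d → (IsWith S u ⊎ IsPlus S u) → child u d ≼ v → d ≡ c u)

InWithRes : Seq → (Addr → Dir) → Addr → Set
InWithRes S c v = Valid S v × (∀ u d → IsWith S u → child u d ≼ v → d ≡ c u)

-- a link is stored as (leaf labelled X , leaf labelled X^⊥)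
Link : Set
Link = Addr × Addr

Linking : Set
Linking = List Link

Net : Set
Net = List Linking

_occursIn_ : Addr → Link → Set
a occursIn ℓ = (a ≡ proj₁ ℓ) ⊎ (a ≡ proj₂ ℓ)

LeafOf : Linking → Addr → Set
LeafOf λ' a = Σ Link λ ℓ → ℓ ∈ λ' × a occursIn ℓ

IsLink : Seq → Link → Set
IsLink S (p , n) = Σ ℕ λ x → lab S p ≡ just (fm (pos x)) × lab S n ≡ just (fm (neg x))

IsLinking : Seq → Linking → Set
IsLinking S λ' =
  All (IsLink S) λ'
  × (∀ ℓ ℓ' → ℓ ∈ λ' → ℓ' ∈ λ' → (Σ Addr λ a → a occursIn ℓ × a occursIn ℓ') → ℓ ≡ ℓ')
  × Σ (ℕ → Bool) λ keep → Σ (Addr → Dir) λ c →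
      ∀ a → IsLeaf S a → (InAddRes S keep c a → LeafOf λ' a) × (LeafOf λ' a → InAddRes S keep c a)

-- the (additive resolution) of a linking: all ancestors of its leaves
ResOf : Linking → Addr → Set
ResOf λ' v = Σ Addr λ a → LeafOf λ' a × v ≼ a

_≈L_ : Linking → Linking → Set
λ₁ ≈L λ₂ = ∀ ℓ → (ℓ ∈ λ₁ → ℓ ∈ λ₂) × (ℓ ∈ λ₂ → ℓ ∈ λ₁)

_≈N_ : Net → Net → Set
θ ≈N η = (∀ λ₁ → λ₁ ∈ θ → Σ Linking λ λ₂ → λ₂ ∈ η × λ₁ ≈L λ₂)
       × (∀ λ₂ → λ₂ ∈ η → Σ Linking λ λ₁ → λ₁ ∈ θ × λ₁ ≈L λ₂)

data Edge : Set where
  tree : Addr → Dir → Edge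
  link : Link → Edge
  jump : Addr → Addr → Edge

ends : Edge → Addr × Addr
ends (tree u d) = u , child u d
ends (link ℓ)   = ℓ
ends (jump l W) = l , W

Joins : Edge → Addr → Addr → Set
Joins e u v = (ends e ≡ (u , v)) ⊎ (ends e ≡ (v , u))

InEdge : Edge → Addr → Set
InEdge (tree u d) v = u ≡ v
InEdge (link _)   v = ⊥
InEdge (jump l W) v = W ≡ v

data Walk (E : Edge → Set) : Addr → Addr → Set where
  stop : ∀ {u} → Walk E u u
  step : ∀ {u w v} e → E e → Joins e u w → Walk E w v → Walk E u v

record Dart : Set where
  constructor dart
  field
    src  : Addr
    edge : Edge
    tgt  : Addr
open Dart public

closes : Addr → Dart → List Dart → Set
closes s d [] = tgt d ≡ s
closes s d (d' ∷ ds) = (tgt d ≡ src d') × closes s d' ds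

IsCycle : (Edge → Set) → List Dart → Set
IsCycle E [] = ⊥
IsCycle E (d ∷ ds) =
  closes (src d) d ds
  × All (λ x → E (edge x) × Joins (edge x) (src x) (tgt x)) (d ∷ ds)
  × Unique (map src (d ∷ ds)) × Unique (map edge (d ∷ ds))

IsTree : (Addr → Set) → (Edge → Set) → Set
IsTree V E = (∀ u v → V u → V v → Walk E u v) × ¬ (Σ (List Dart) (IsCycle E))

SwitchingCycle : Seq → (Edge → Set) → List Dart → Set
SwitchingCycle S E ds =
  IsCycle E ds
  × (∀ v → (IsPar S v ⊎ IsWith S v) → ∀ e e' → e ∈ map edge ds → e' ∈ map edge ds
       → InEdge e v → InEdge e' v → e ≡ e')

SwE : Seq → Linking → (Addr → Dir) → Edge → Set
SwE S λ' s (tree u d) = ResOf λ' u × ResOf λ' (child u d) × ¬ (IsPar S u × s u ≡ d)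
SwE S λ' s (link ℓ)   = ℓ ∈ λ'
SwE S λ' s (jump _ _) = ⊥

UnionRes : List Linking → Addr → Set
UnionRes Λ v = Σ Linking λ λ' → λ' ∈ Λ × ResOf λ' v

Toggles : Seq → List Linking → Addr → Set
Toggles S Λ W = IsWith S W × UnionRes Λ (child W L) × UnionRes Λ (child W R)

Depends : Seq → List Linking → Link → Addr → Set
Depends S Λ a W = Σ Linking λ λ₁ → Σ Linking λ λ₂ →
  λ₁ ∈ Λ × λ₂ ∈ Λ × a ∈ λ₁ × a ∉ λ₂
  × Toggles S (λ₁ ∷ λ₂ ∷ []) W
  × (∀ W' → Toggles S (λ₁ ∷ λ₂ ∷ []) W' → W' ≡ W)

GE : Seq → List Linking → Edge → Set
GE S Λ (tree u d) = UnionRes Λ u × UnionRes Λ (child u d)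
GE S Λ (link ℓ)   = Σ Linking λ λ' → λ' ∈ Λ × ℓ ∈ λ'
GE S Λ (jump l W) = Σ Link λ a → (Σ Linking λ λ' → λ' ∈ Λ × a ∈ λ') × l occursIn a × Depends S Λ a W

record IsProofNet (S : Seq) (θ : Net) : Set where
  field
    linkings : All (IsLinking S) θ
    P0 : ∀ i → i < length (cuts S) →
           Σ Linking λ λ' → λ' ∈ θ × Σ Addr λ a → LeafOf λ' a × InCut i a
    P1 : ∀ (c : Addr → Dir) →
           (Σ Linking λ λ' → λ' ∈ θ × (∀ v → ResOf λ' v → InWithRes S c v))
           × (∀ λ₁ λ₂ → λ₁ ∈ θ → λ₂ ∈ θ
                → (∀ v → ResOf λ₁ v → InWithRes S c v)
                → (∀ v → ResOf λ₂ v → InWithRes S c v) → λ₁ ≈L λ₂)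
    P2 : ∀ λ' → λ' ∈ θ → ∀ (s : Addr → Dir) → IsTree (ResOf λ') (SwE S λ' s)
    P3 : ∀ (Λ : List Linking) → All (_∈ θ) Λ
           → (Σ Linking λ λ₁ → Σ Linking λ λ₂ → λ₁ ∈ Λ × λ₂ ∈ Λ × ¬ (λ₁ ≈L λ₂))
           → Σ Addr λ W → Toggles S Λ W
               × ¬ (Σ (List Dart) λ ds → SwitchingCycle S (GE S Λ) ds × W ∈ map src ds)

State : Set
State = Seq × Net

mapLinking : (Addr → Addr) → Linking → Linking
mapLinking f = map (λ ℓ → f (proj₁ ℓ) , f (proj₂ ℓ))

mapNet : (Addr → Addr) → Net → Net
mapNet f = map (mapLinking f)

-- composition over C of θ (conclusions Γ₁ , C , Γ₂) and ψ (conclusions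
-- Δ₁ , C^⊥ , Δ₂): the net on [C * C^⊥] Γ₁,Γ₂,Δ₁,Δ₂ of all unions λ ∪ μ
compose : List Fm → Fm → List Fm → Net → List Fm → List Fm → Net → State
compose Γ₁ C Γ₂ θ Δ₁ Δ₂ ψ =
  seq (C ∷ []) (Γ₁ ++ Γ₂ ++ Δ₁ ++ Δ₂) ,
  concatMap (λ λ' → map (λ μ → mapLinking f λ' ++ mapLinking g μ) ψ) θ
  where
  g1 = length Γ₁
  d1 = length Δ₁
  off = length Γ₁ + length Γ₂
  f : Addr → Addr
  f (gv k p) = if k <ᵇ g1 then gv k p else (if k ≡ᵇ g1 then cl 0 p else gv (k ∸ 1) p)
  f a = a
  g : Addr → Addr
  g (gv k p) = if k <ᵇ d1 then gv (off + k) p else (if k ≡ᵇ d1 then cr 0 p else gv (off + (k ∸ 1)) p)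
  g a = a

inCutᵇ : ℕ → Addr → Bool
inCutᵇ i (cv k)   = k ≡ᵇ i
inCutᵇ i (cl k _) = k ≡ᵇ i
inCutᵇ i (cr k _) = k ≡ᵇ i
inCutᵇ i (gv _ _) = false

isCL0 isCR0 : ℕ → Addr → Bool
isCL0 i (cl k []) = k ≡ᵇ i
isCL0 i _ = false
isCR0 i (cr k []) = k ≡ᵇ i
isCR0 i _ = false

dirEq : Dir → Dir → Bool
dirEq L L = true
dirEq R R = true
dirEq _ _ = false

underCL underCR : ℕ → Dir → Addr → Bool
underCL i d (cl k (d' ∷ _)) = (k ≡ᵇ i) ∧ dirEq d d'
underCL i d _ = false
underCR i d (cr k (d' ∷ _)) = (k ≡ᵇ i) ∧ dirEq d d'
underCR i d _ = false

removeAtℕ : ∀ {a} {X : Set a} → List X → ℕ → List X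
removeAtℕ [] _ = []
removeAtℕ (x ∷ xs) zero = xs
removeAtℕ (x ∷ xs) (suc n) = x ∷ removeAtℕ xs n

setAtℕ : ∀ {a} {X : Set a} → List X → ℕ → X → List X
setAtℕ [] _ _ = []
setAtℕ (x ∷ xs) zero y = y ∷ xs
setAtℕ (x ∷ xs) (suc n) y = x ∷ setAtℕ xs n y

reindexCuts : (ℕ → ℕ) → Addr → Addr
reindexCuts r (cv k) = cv (r k)
reindexCuts r (cl k p) = cl (r k) p
reindexCuts r (cr k p) = cr (r k) p
reindexCuts r (gv j p) = gv j p

dropCut : ℕ → Addr → Addr
dropCut i = reindexCuts (λ k → if i <ᵇ k then k ∸ 1 else k)

-- atomic cut X * X^⊥ (i-th pair): merge (l , X) and (X^⊥ , m) into (l , m)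
touches : ℕ → Link → Bool
touches i ℓ = inCutᵇ i (proj₁ ℓ) ∨ inCutᵇ i (proj₂ ℓ)

mergePos : ℕ → Linking → Linking   -- cut formula X: cl i [] positive
mergePos i λ' =
  filterᵇ (λ ℓ → not (touches i ℓ)) λ'
  ++ concatMap (λ m → map (λ l → m , l) ls) ms
  where
  ls = concatMap (λ ℓ → if isCL0 i (proj₁ ℓ) then proj₂ ℓ ∷ [] else []) λ'
  ms = concatMap (λ ℓ → if isCR0 i (proj₂ ℓ) then proj₁ ℓ ∷ [] else []) λ'

mergeNeg : ℕ → Linking → Linking   -- cut formula X^⊥: cl i [] negative
mergeNeg i λ' =
  filterᵇ (λ ℓ → not (touches i ℓ)) λ'
  ++ concatMap (λ l → map (λ m → l , m) ms) ls
  where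
  ls = concatMap (λ ℓ → if isCL0 i (proj₂ ℓ) then proj₁ ℓ ∷ [] else []) λ'
  ms = concatMap (λ ℓ → if isCR0 i (proj₁ ℓ) then proj₂ ℓ ∷ [] else []) λ'

-- splitting the i-th cut pair (D∘E) * (E^⊥ ∘' D^⊥) into D * D^⊥ (kept at
-- index i) and E * E^⊥ (appended at index n = number of cut pairs)
splitAddr : ℕ → ℕ → Addr → Addr
splitAddr i n (cl k (L ∷ p)) = if k ≡ᵇ i then cl i p else cl k (L ∷ p)
splitAddr i n (cl k (R ∷ p)) = if k ≡ᵇ i then cl n p else cl k (R ∷ p)
splitAddr i n (cr k (R ∷ p)) = if k ≡ᵇ i then cr i p else cr k (R ∷ p)
splitAddr i n (cr k (L ∷ p)) = if k ≡ᵇ i then cr n p else cr k (L ∷ p)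
splitAddr i n a = a

anyLeaf : (Addr → Bool) → Linking → Bool
anyLeaf P = any (λ ℓ → P (proj₁ ℓ) ∨ P (proj₂ ℓ))

nonDual : ℕ → Linking → Bool
nonDual i λ' =
  (anyLeaf (underCL i L) λ' ∧ anyLeaf (underCR i L) λ')
  ∨ (anyLeaf (underCL i R) λ' ∧ anyLeaf (underCR i R) λ')

used : Net → ℕ → Bool
used θ k = any (anyLeaf (inCutᵇ k)) θ

rank : (ℕ → Bool) → ℕ → ℕ
rank u zero = zero
rank u (suc k) = rank u k + (if u k then 1 else 0)

keepCuts : (ℕ → Bool) → ℕ → List Fm → List Fm
keepCuts u k [] = []
keepCuts u k (C ∷ Cs) = if u k then C ∷ keepCuts u (suc k) Cs else keepCuts u (suc k) Cs

gc : State → State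
gc (S , θ) = seq (keepCuts (used θ) 0 (cuts S)) (concl S) , mapNet (reindexCuts (rank (used θ))) θ

splitMult : State → ℕ → Fm → Fm → State
splitMult (S , θ) i D E =
  seq (setAtℕ (cuts S) i D ++ E ∷ []) (concl S) , mapNet (splitAddr i (length (cuts S))) θ

splitAdd : State → ℕ → Fm → Fm → State
splitAdd (S , θ) i D E =
  gc (seq (setAtℕ (cuts S) i D ++ E ∷ []) (concl S)
     , mapNet (splitAddr i (length (cuts S))) (filterᵇ (λ λ' → not (nonDual i λ')) θ))

stepAt : State → ℕ → Maybe State
stepAt (S , θ) i with nth (cuts S) i
... | nothing = nothing
... | just (pos x) = just (seq (removeAtℕ (cuts S) i) (concl S) , mapNet (dropCut i) (map (mergePos i) θ))
... | just (neg x) = just (seq (removeAtℕ (cuts S) i) (concl S) , mapNet (dropCut i) (map (mergeNeg i) θ))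
... | just (D ⊗ E) = just (splitMult (S , θ) i D E)
... | just (D ⅋ E) = just (splitMult (S , θ) i D E)
... | just (D & E) = just (splitAdd (S , θ) i D E)
... | just (D ⊕ E) = just (splitAdd (S , θ) i D E)

data _⟶_ : State → State → Set where
  step : ∀ {st st'} i → stepAt st i ≡ just st' → st ⟶ st'

_⟶*_ : State → State → Set
_⟶*_ = Star _⟶_

-- relocate a net on ⊢ B^⊥ , B into ⊢ A^⊥ , A: B^⊥ sits at direction d0
-- below the root of A^⊥, B at direction d1 below the root of A
reloc : Dir → Dir → Addr → Addr
reloc d0 d1 (gv 0 p) = gv 0 (d0 ∷ p)
reloc d0 d1 (gv 1 p) = gv 1 (d1 ∷ p)
reloc d0 d1 a = a

-- for A = B ∘ C we have A^⊥ = C^⊥ ∘' B^⊥: B^⊥ is the R-argument of A^⊥ and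
-- B the L-argument of A; C^⊥ is the L-argument of A^⊥, C the R-argument of A
idMult : Net → Net → Net   -- ⊗ rule (after ⅋): pairwise unions
idMult θ ψ = concatMap (λ λ' → map (λ μ → mapLinking (reloc R L) λ' ++ mapLinking (reloc L R) μ) ψ) θ

idAdd : Net → Net → Net    -- & rule (after ⊕): union of the sets
idAdd θ ψ = mapNet (reloc R L) θ ++ mapNet (reloc L R) ψ

-- identity proof-net of A on ⊢ A^⊥ , A (translation of the fully
-- axiom-expanded axiom proof); links stored as (X-leaf , X^⊥-leaf)
idNet : Fm → Net
idNet (pos x) = ((gv 1 [] , gv 0 []) ∷ []) ∷ []
idNet (neg x) = ((gv 0 [] , gv 1 []) ∷ []) ∷ []
idNet (B ⊗ C) = idMult (idNet B) (idNet C)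
idNet (B ⅋ C) = idMult (idNet B) (idNet C)
idNet (B & C) = idAdd (idNet B) (idNet C)
idNet (B ⊕ C) = idAdd (idNet B) (idNet C)

ReducesTo : State → State → Set
ReducesTo st (S , η) = Σ State λ st' → st ⟶* st' × proj₁ st' ≡ S × proj₂ st' ≈N η

InConcl : ℕ → Addr → Set
InConcl j (gv k _) = k ≡ j
InConcl j _ = ⊥

Bipartite : Net → Set
Bipartite θ = ∀ λ' → λ' ∈ θ → ∀ ℓ → ℓ ∈ λ' →
  (InConcl 0 (proj₁ ℓ) × InConcl 1 (proj₂ ℓ)) ⊎ (InConcl 1 (proj₁ ℓ) × InConcl 0 (proj₂ ℓ))

Full : Seq → Net → Set
Full S θ = ∀ a → IsLeaf S a → Σ Linking λ λ' → λ' ∈ θ × LeafOf λ' a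

{-# OPTIONS --safe #-}
module Submission where

-- Call a leaf set of A and one of A⊥ coherent if, after dualising the latter, no two of
-- their paths part at an additive vertex. A pair of linkings that is coherent over the cut
-- formula survives cut elimination together with all its links between conclusions, and
-- leaves of conclusions in the result of cut elimination already occur in its source.
-- Given λ in θ, the identity of A has a linking on the resolution of A⊥ used by λ; it comes
-- from some pair (λ₁ , μ), and μ is then coherent with λ over A, so that λ survives in the
-- composition over A and a link of λ inside B would be a link of the identity of B with both
-- ends in the same conclusion. Exchanging A and B excludes links inside A⊥. Fullness holds
-- because every leaf occurs in the identity, hence in its source.

open import Defs
open import Data.Bool using (Bool; true; false; T; _∧_; not; if_then_else_)
open import Data.Bool.Properties using (T-≡; T-∧; T-∨)
open import Data.Empty using (⊥-elim)
open import Data.List using (List; []; _∷_; _++_; map; concatMap; filterᵇ; length)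
open import Data.List.Membership.Propositional using (_∈_; lose; find)
open import Data.List.Membership.Propositional.Properties
  using (∈-map⁺; ∈-map⁻; ∈-++⁺ˡ; ∈-++⁺ʳ; ∈-++⁻; ∈-concatMap⁺; ∈-concatMap⁻; ∈-filter⁺; ∈-filter⁻)
open import Data.List.Properties using (++-assoc; ++-identityʳ)
open import Data.List.Relation.Unary.All using (All) renaming (lookup to lookupAll)
open import Data.List.Relation.Unary.Any using (here)
open import Data.List.Relation.Unary.Any.Properties using (any⁺; any⁻)
open import Data.Maybe using (Maybe; just; nothing)
import Data.Maybe as Maybe
open import Data.Nat using (ℕ; zero; suc; _+_; _∸_; _≤_; _<_; _≡ᵇ_; _<ᵇ_)
open import Data.Nat.Properties
  using (+-suc; suc-injective; m≤n⇒∃[o]m+o≡n; +-identityʳ; +-assoc; +-comm; ≡ᵇ⇒≡; ≡⇒≡ᵇ; ≤-trans; ≤-reflexive; m≤m+n; <-cmp; <⇒≢)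
open import Data.Product using (Σ; _×_; _,_; proj₁; proj₂)
open import Data.Sum using (_⊎_; inj₁; inj₂; [_,_]′)
open import Data.Unit using (tt)
open import Function using (_∘_; Equivalence)
open import Relation.Binary.Definitions using (tri<; tri≈; tri>)
open import Relation.Binary.Construct.Closure.ReflexiveTransitive using (ε; _◅_)
open import Relation.Binary.PropositionalEquality
  using (_≡_; _≢_; refl; sym; trans; cong; cong₂; subst; subst₂)
open import Relation.Nullary using (¬_)
open import Relation.Nullary.Decidable using (T?)

-- Paths and the duality of formulas

opp : Dir → Dir
opp L = R
opp R = L

-- Duality exchanges the arguments of every connective, so the vertex of `A` at `p` faces the vertex
-- of `dual A` at `flip p`.
flip : Path → Path
flip = map opp

opp-involutive : ∀ d → opp (opp d) ≡ d
opp-involutive L = refl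
opp-involutive R = refl

flip-involutive : ∀ p → flip (flip p) ≡ p
flip-involutive []      = refl
flip-involutive (d ∷ p) = cong₂ _∷_ (opp-involutive d) (flip-involutive p)

flip-++ : ∀ r d s → flip (r ++ d ∷ s) ≡ flip r ++ opp d ∷ flip s
flip-++ []      d s = refl
flip-++ (e ∷ r) d s = cong (opp e ∷_) (flip-++ r d s)

flip-uncons : ∀ p r d s → flip p ≡ r ++ d ∷ s → p ≡ flip r ++ opp d ∷ flip s
flip-uncons p r d s eq =
  trans (sym (flip-involutive p)) (trans (cong flip eq) (flip-++ r d s))

sub-flip : ∀ A p → sub (dual A) (flip p) ≡ Maybe.map dual (sub A p)
sub-flip A       []      = refl
sub-flip (pos x) (d ∷ p) = refl
sub-flip (neg x) (d ∷ p) = refl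
sub-flip (A ⊗ B) (L ∷ p) = sub-flip A p
sub-flip (A ⊗ B) (R ∷ p) = sub-flip B p
sub-flip (A ⅋ B) (L ∷ p) = sub-flip A p
sub-flip (A ⅋ B) (R ∷ p) = sub-flip B p
sub-flip (A & B) (L ∷ p) = sub-flip A p
sub-flip (A & B) (R ∷ p) = sub-flip B p
sub-flip (A ⊕ B) (L ∷ p) = sub-flip A p
sub-flip (A ⊕ B) (R ∷ p) = sub-flip B p

Atomic : Maybe Fm → Set
Atomic m = Σ ℕ λ x → m ≡ just (pos x) ⊎ m ≡ just (neg x)

atomic≢nothing : ∀ {m} → Atomic m → m ≢ nothing
atomic≢nothing (_ , inj₁ refl) ()
atomic≢nothing (_ , inj₂ refl) ()

data Additive : Maybe Fm → Set where
  with′ : ∀ {A B} → Additive (just (A & B))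
  plus′ : ∀ {A B} → Additive (just (A ⊕ B))

Atomic-undual : ∀ m → Atomic (Maybe.map dual m) → Atomic m
Atomic-undual (just (pos x)) _ = x , inj₁ refl
Atomic-undual (just (neg x)) _ = x , inj₂ refl
Atomic-undual (just (_ ⊗ _)) (_ , inj₁ ())
Atomic-undual (just (_ ⊗ _)) (_ , inj₂ ())
Atomic-undual (just (_ ⅋ _)) (_ , inj₁ ())
Atomic-undual (just (_ ⅋ _)) (_ , inj₂ ())
Atomic-undual (just (_ & _)) (_ , inj₁ ())
Atomic-undual (just (_ & _)) (_ , inj₂ ())
Atomic-undual (just (_ ⊕ _)) (_ , inj₁ ())
Atomic-undual (just (_ ⊕ _)) (_ , inj₂ ())
Atomic-undual nothing        (_ , inj₁ ())
Atomic-undual nothing        (_ , inj₂ ())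

Additive-dual : ∀ {m} → Additive m → Additive (Maybe.map dual m)
Additive-dual with′ = plus′
Additive-dual plus′ = with′

Additive-flip : ∀ A r → Additive (sub A r) → Additive (sub (dual A) (flip r))
Additive-flip A r add = subst Additive (sym (sub-flip A r)) (Additive-dual add)

-- A function `c` encodes an additive resolution by its choice at each `&` or `⊕`; here `r` runs
-- over the vertices at which `p` makes a step `d`.
Follows : (Path → Dir) → Fm → Path → Set
Follows c A p = ∀ r d s → p ≡ r ++ d ∷ s → Additive (sub A r) → d ≡ c r

OnResolution : (Path → Dir) → Fm → Path → Set
OnResolution c A p = Atomic (sub A p) × Follows c A p

-- p and q do not part at an additive vertex of A; they need not be paths of A.
Coh : Fm → Path → Path → Set
Coh A p q = ∀ r d e s t → p ≡ r ++ d ∷ s → q ≡ r ++ e ∷ t → Additive (sub A r) → d ≡ e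

follows⇒coh : ∀ {c A p q} → Follows c A p → Follows c A q → Coh A p q
follows⇒coh fp fq r d e s t eqp eqq add = trans (fp r d s eqp add) (sym (fq r e t eqq add))

coh-[]ˡ : ∀ {A q} → Coh A [] q
coh-[]ˡ []      d e s t () _ _
coh-[]ˡ (_ ∷ _) d e s t () _ _

coh-[]ʳ : ∀ {A p} → Coh A p []
coh-[]ʳ []      d e s t _ () _
coh-[]ʳ (_ ∷ _) d e s t _ () _

-- If `p` and `flip q` part at `r`, then `flip p` and `q` part at `flip r`, and duality keeps
-- additive vertices additive.
coh-undual : ∀ {A} p q → Coh (dual A) (flip p) q → Coh A p (flip q)
coh-undual {A} p q coh r d e s t eqp eqq add =
  trans (sym (opp-involutive d)) (trans (cong opp step′) (opp-involutive e))
  where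
  step′ : opp d ≡ opp e
  step′ = coh (flip r) (opp d) (opp e) (flip s) (flip t)
            (trans (cong flip eqp) (flip-++ r d s)) (flip-uncons q r e t eqq)
            (Additive-flip A r add)

dualChoice : (Path → Dir) → Path → Dir
dualChoice c r = opp (c (flip r))

onResolution-undual : ∀ {c A} q → OnResolution c (dual A) q
  → OnResolution (dualChoice c) A (flip q)
onResolution-undual {c} {A} q (at , fol) =
    Atomic-undual _ (subst Atomic eq at)
  , λ r d s eqp add → trans (sym (opp-involutive d))
      (cong opp (fol (flip r) (opp d) (flip s) (flip-uncons q r d s eqp) (Additive-flip A r add)))
  where
  eq : sub (dual A) q ≡ Maybe.map dual (sub A (flip q))
  eq = trans (cong (sub (dual A)) (sym (flip-involutive q))) (sub-flip A (flip q))

-- Only the depth of the vertex counts: the value is the step that `p` takes at that depth, with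
-- default `L` past its end. This is correct at the vertices passed by `p` itself.
along : Path → Path → Dir
along []      _       = L
along (d ∷ p) []      = d
along (d ∷ p) (_ ∷ r) = along p r

follows-along : ∀ A p → Follows (along p) A p
follows-along A p r d s eq _ = subst (λ p → d ≡ along p r) (sym eq) (along-++ r)
  where
  along-++ : ∀ r → d ≡ along (r ++ d ∷ s) r
  along-++ []      = refl
  along-++ (_ ∷ r) = along-++ r

-- Leaves of linkings

leaf₁ : ∀ {λ' ℓ} → ℓ ∈ λ' → LeafOf λ' (proj₁ ℓ)
leaf₁ ℓ∈ = _ , ℓ∈ , inj₁ refl

leaf₂ : ∀ {λ' ℓ} → ℓ ∈ λ' → LeafOf λ' (proj₂ ℓ)
leaf₂ ℓ∈ = _ , ℓ∈ , inj₂ refl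

leaf-⊆ : ∀ {λ' μ a} → (∀ {ℓ} → ℓ ∈ λ' → ℓ ∈ μ) → LeafOf λ' a → LeafOf μ a
leaf-⊆ ⊆μ (ℓ , ℓ∈ , occ) = ℓ , ⊆μ ℓ∈ , occ

leaf-map⁺ : ∀ f {λ' a} → LeafOf λ' a → LeafOf (mapLinking f λ') (f a)
leaf-map⁺ f (ℓ , ℓ∈ , inj₁ refl) = leaf₁ (∈-map⁺ _ ℓ∈)
leaf-map⁺ f (ℓ , ℓ∈ , inj₂ refl) = leaf₂ (∈-map⁺ _ ℓ∈)

leaf-map⁻ : ∀ f {λ' b} → LeafOf (mapLinking f λ') b → Σ Addr λ a → LeafOf λ' a × f a ≡ b
leaf-map⁻ f (ℓ , ℓ∈ , occ) with ∈-map⁻ _ ℓ∈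
leaf-map⁻ f (ℓ , ℓ∈ , inj₁ refl) | ℓ₀ , ℓ₀∈ , refl = _ , leaf₁ ℓ₀∈ , refl
leaf-map⁻ f (ℓ , ℓ∈ , inj₂ refl) | ℓ₀ , ℓ₀∈ , refl = _ , leaf₂ ℓ₀∈ , refl

leaf-++⁻ : ∀ λ' {μ a} → LeafOf (λ' ++ μ) a → LeafOf λ' a ⊎ LeafOf μ a
leaf-++⁻ λ' (ℓ , ℓ∈ , occ) with ∈-++⁻ λ' ℓ∈
... | inj₁ ℓ∈λ = inj₁ (ℓ , ℓ∈λ , occ)
... | inj₂ ℓ∈μ = inj₂ (ℓ , ℓ∈μ , occ)

anyLeaf⁻ : ∀ P λ' → T (anyLeaf P λ') → Σ Addr λ a → LeafOf λ' a × T (P a)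
anyLeaf⁻ P λ' t with find (any⁻ _ λ' t)
... | ℓ , ℓ∈ , tℓ with Equivalence.to T-∨ tℓ
... | inj₁ t₁ = _ , leaf₁ ℓ∈ , t₁
... | inj₂ t₂ = _ , leaf₂ ℓ∈ , t₂

anyLeaf⁺ : ∀ P {λ' a} → LeafOf λ' a → T (P a) → T (anyLeaf P λ')
anyLeaf⁺ P (ℓ , ℓ∈ , inj₁ refl) t = any⁺ _ (lose ℓ∈ (Equivalence.from T-∨ (inj₁ t)))
anyLeaf⁺ P (ℓ , ℓ∈ , inj₂ refl) t = any⁺ _ (lose ℓ∈ (Equivalence.from (T-∨ {P (proj₁ ℓ)}) (inj₂ t)))

-- Composition of nets, the multiplicative case of the identity and the merging of links at an
-- atomic cut all have this shape.
∈-pairs⁻ : ∀ {X Y Z : Set} (f : X → Y → Z) xs ys {z}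
  → z ∈ concatMap (λ x → map (f x) ys) xs
  → Σ X λ x → Σ Y λ y → x ∈ xs × y ∈ ys × z ≡ f x y
∈-pairs⁻ f xs ys z∈ with find (∈-concatMap⁻ (λ x → map (f x) ys) {xs = xs} z∈)
... | x , x∈ , z∈′ with ∈-map⁻ (f x) z∈′
... | y , y∈ , eq = x , y , x∈ , y∈ , eq

∈-pairs⁺ : ∀ {X Y Z : Set} (f : X → Y → Z) {xs ys x y} → x ∈ xs → y ∈ ys
  → f x y ∈ concatMap (λ x → map (f x) ys) xs
∈-pairs⁺ f {ys = ys} x∈ y∈ = ∈-concatMap⁺ (λ x → map (f x) ys) (lose x∈ (∈-map⁺ (f _) y∈))

∈-select⁻ : ∀ (P : Link → Bool) (g : Link → Addr) λ' {a}
  → a ∈ concatMap (λ ℓ → if P ℓ then g ℓ ∷ [] else []) λ' → Σ Link λ ℓ → ℓ ∈ λ' × a ≡ g ℓ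
∈-select⁻ P g λ' a∈ with find (∈-concatMap⁻ (λ ℓ → if P ℓ then g ℓ ∷ [] else []) {xs = λ'} a∈)
... | ℓ , ℓ∈ , a∈′ with P ℓ
∈-select⁻ P g λ' a∈ | ℓ , ℓ∈ , here eq | true = ℓ , ℓ∈ , eq

-- Identity proof-nets

Covers : (Path → Dir) → Fm → Linking → Set
Covers c A ι = ∀ p → OnResolution c A p → LeafOf ι (gv 1 p) × LeafOf ι (gv 0 (flip p))

Covered : (Path → Dir) → Fm → Set
Covered c A = Σ Linking λ ι → ι ∈ idNet A × Covers c A ι

leaf-reloc : ∀ d {ι} p → LeafOf ι (gv 1 p) × LeafOf ι (gv 0 (flip p))
  → LeafOf (mapLinking (reloc (opp d) d) ι) (gv 1 (d ∷ p))
    × LeafOf (mapLinking (reloc (opp d) d) ι) (gv 0 (flip (d ∷ p)))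
leaf-reloc d p (l₁ , l₀) = leaf-map⁺ (reloc (opp d) d) l₁ , leaf-map⁺ (reloc (opp d) d) l₀

onResolution-arg : ∀ {c A B} d p → (∀ q → sub A (d ∷ q) ≡ sub B q)
  → OnResolution c A (d ∷ p) → OnResolution (c ∘ (d ∷_)) B p
onResolution-arg d p eq (at , fol) =
    subst Atomic (eq p) at
  , λ r e s eqp add → fol (d ∷ r) e s (cong (d ∷_) eqp) (subst Additive (sym (eq r)) add)

cover-mult : ∀ c {A B C} → ¬ Atomic (sub A [])
  → (∀ q → sub A (L ∷ q) ≡ sub B q) → (∀ q → sub A (R ∷ q) ≡ sub C q)
  → idNet A ≡ idMult (idNet B) (idNet C)
  → Covered (c ∘ (L ∷_)) B → Covered (c ∘ (R ∷_)) C → Covered c A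
cover-mult c {A} ¬at eqL eqR eqN (ι , ι∈ , covB) (κ , κ∈ , covC) =
  ν , subst (ν ∈_) (sym eqN) (∈-pairs⁺ (λ λ' μ → mapLinking (reloc R L) λ' ++ mapLinking (reloc L R) μ) ι∈ κ∈) , cov
  where
  ν : Linking
  ν = mapLinking (reloc R L) ι ++ mapLinking (reloc L R) κ

  cov : Covers c A ν
  cov []      (at , _) = ⊥-elim (¬at at)
  cov (L ∷ p) on with leaf-reloc L p (covB p (onResolution-arg L p eqL on))
  ... | l₁ , l₀ = leaf-⊆ ∈-++⁺ˡ l₁ , leaf-⊆ ∈-++⁺ˡ l₀
  cov (R ∷ p) on with leaf-reloc R p (covC p (onResolution-arg R p eqR on))
  ... | l₁ , l₀ = leaf-⊆ (∈-++⁺ʳ _) l₁ , leaf-⊆ (∈-++⁺ʳ _) l₀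

-- The linking of the argument kept by `c []` is enough, because no path into the other argument
-- follows `c` at the root.
cover-add : ∀ c {A B C} → Additive (sub A []) → ¬ Atomic (sub A [])
  → (∀ q → sub A (L ∷ q) ≡ sub B q) → (∀ q → sub A (R ∷ q) ≡ sub C q)
  → idNet A ≡ idAdd (idNet B) (idNet C)
  → Covered (c ∘ (L ∷_)) B → Covered (c ∘ (R ∷_)) C → Covered c A
cover-add c {A} {B} {C} add ¬at eqL eqR eqN (ι , ι∈ , covB) (κ , κ∈ , covC) = go (c []) refl
  where
  go : ∀ d → c [] ≡ d → Covered c A
  go L c≡ = mapLinking (reloc R L) ι
          , subst (_ ∈_) (sym eqN) (∈-++⁺ˡ (∈-map⁺ _ ι∈)) , cov
    where
    cov : Covers c A (mapLinking (reloc R L) ι)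
    cov []      (at , _)   = ⊥-elim (¬at at)
    cov (L ∷ p) on         = leaf-reloc L p (covB p (onResolution-arg L p eqL on))
    cov (R ∷ p) (_ , fol) with trans (fol [] R p refl add) c≡
    ... | ()
  go R c≡ = mapLinking (reloc L R) κ
          , subst (_ ∈_) (sym eqN) (∈-++⁺ʳ (mapNet (reloc R L) (idNet B)) (∈-map⁺ _ κ∈)) , cov
    where
    cov : Covers c A (mapLinking (reloc L R) κ)
    cov []      (at , _)   = ⊥-elim (¬at at)
    cov (R ∷ p) on         = leaf-reloc R p (covC p (onResolution-arg R p eqR on))
    cov (L ∷ p) (_ , fol) with trans (fol [] L p refl add) c≡
    ... | ()

-- Provides a linking of the identity on any prescribed resolution. Recording its leaves suffices
-- for finding partners, since coherence speaks of leaves alone.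
idNet-covers : ∀ A c → Covered c A
idNet-covers (pos x) c = _ , here refl , cov
  where
  cov : Covers c (pos x) _
  cov []      _               = leaf₁ (here refl) , leaf₂ (here refl)
  cov (_ ∷ _) ((_ , inj₁ ()) , _)
  cov (_ ∷ _) ((_ , inj₂ ()) , _)
idNet-covers (neg x) c = _ , here refl , cov
  where
  cov : Covers c (neg x) _
  cov []      _               = leaf₂ (here refl) , leaf₁ (here refl)
  cov (_ ∷ _) ((_ , inj₁ ()) , _)
  cov (_ ∷ _) ((_ , inj₂ ()) , _)
idNet-covers (B ⊗ C) c = cover-mult c (λ { (_ , inj₁ ()) ; (_ , inj₂ ()) })
  (λ _ → refl) (λ _ → refl) refl (idNet-covers B _) (idNet-covers C _)
idNet-covers (B ⅋ C) c = cover-mult c (λ { (_ , inj₁ ()) ; (_ , inj₂ ()) })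
  (λ _ → refl) (λ _ → refl) refl (idNet-covers B _) (idNet-covers C _)
idNet-covers (B & C) c = cover-add c with′ (λ { (_ , inj₁ ()) ; (_ , inj₂ ()) })
  (λ _ → refl) (λ _ → refl) refl (idNet-covers B _) (idNet-covers C _)
idNet-covers (B ⊕ C) c = cover-add c plus′ (λ { (_ , inj₁ ()) ; (_ , inj₂ ()) })
  (λ _ → refl) (λ _ → refl) refl (idNet-covers B _) (idNet-covers C _)

-- Bipartiteness of identity nets

Across : Link → Set
Across ℓ = (InConcl 0 (proj₁ ℓ) × InConcl 1 (proj₂ ℓ)) ⊎ (InConcl 1 (proj₁ ℓ) × InConcl 0 (proj₂ ℓ))

reloc-InConcl : ∀ d e {j} a → InConcl j a → InConcl j (reloc d e a)
reloc-InConcl d e (gv 0 _)             h = h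
reloc-InConcl d e (gv 1 _)             h = h
reloc-InConcl d e (gv (suc (suc _)) _) h = h

bipartite-reloc : ∀ d e {λ' ℓ} → (∀ ℓ → ℓ ∈ λ' → Across ℓ)
  → ℓ ∈ mapLinking (reloc d e) λ' → Across ℓ
bipartite-reloc d e bip ℓ∈ with ∈-map⁻ _ ℓ∈
... | (a , b) , ℓ₀∈ , refl with bip _ ℓ₀∈
... | inj₁ (a0 , b1) = inj₁ (reloc-InConcl d e a a0 , reloc-InConcl d e b b1)
... | inj₂ (a1 , b0) = inj₂ (reloc-InConcl d e a a1 , reloc-InConcl d e b b0)

bipartite-idMult : ∀ {θ ψ} → Bipartite θ → Bipartite ψ → Bipartite (idMult θ ψ)
bipartite-idMult {θ} {ψ} bθ bψ ν ν∈ ℓ ℓ∈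
  with ∈-pairs⁻ (λ λ' μ → mapLinking (reloc R L) λ' ++ mapLinking (reloc L R) μ) θ ψ ν∈
... | λ' , μ , λ∈ , μ∈ , refl with ∈-++⁻ (mapLinking (reloc R L) λ') ℓ∈
... | inj₁ ℓ∈₁ = bipartite-reloc R L (bθ λ' λ∈) ℓ∈₁
... | inj₂ ℓ∈₂ = bipartite-reloc L R (bψ μ μ∈) ℓ∈₂

bipartite-idAdd : ∀ {θ ψ} → Bipartite θ → Bipartite ψ → Bipartite (idAdd θ ψ)
bipartite-idAdd {θ} {ψ} bθ bψ ν ν∈ ℓ ℓ∈ with ∈-++⁻ (mapNet (reloc R L) θ) ν∈
... | inj₁ ν∈₁ with ∈-map⁻ _ ν∈₁
...   | λ' , λ∈ , refl = bipartite-reloc R L (bθ λ' λ∈) ℓ∈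
bipartite-idAdd {θ} {ψ} bθ bψ ν ν∈ ℓ ℓ∈ | inj₂ ν∈₂ with ∈-map⁻ _ ν∈₂
...   | μ , μ∈ , refl = bipartite-reloc L R (bψ μ μ∈) ℓ∈

bipartite-idNet : ∀ A → Bipartite (idNet A)
bipartite-idNet (pos x) _ (here refl) _ (here refl) = inj₂ (refl , refl)
bipartite-idNet (neg x) _ (here refl) _ (here refl) = inj₁ (refl , refl)
bipartite-idNet (B ⊗ C) = bipartite-idMult (bipartite-idNet B) (bipartite-idNet C)
bipartite-idNet (B ⅋ C) = bipartite-idMult (bipartite-idNet B) (bipartite-idNet C)
bipartite-idNet (B & C) = bipartite-idAdd (bipartite-idNet B) (bipartite-idNet C)
bipartite-idNet (B ⊕ C) = bipartite-idAdd (bipartite-idNet B) (bipartite-idNet C)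

-- Reduction steps

InTree : List Fm → ℕ → Path → Set
InTree Cs k p = Σ Fm λ C → nth Cs k ≡ just C × sub C p ≢ nothing

-- Only an upper bound on the leaves is imposed, so that the property is inherited by
-- linkings with fewer leaves. A link joining both sides of a single atomic cut turns into
-- a junk link at the root of the next cut pair; this is why roots are not constrained.
record Coherent (Cs : List Fm) (λ' : Linking) : Set where
  field
    inTreeˡ : ∀ k d p → LeafOf λ' (cl k (d ∷ p)) → InTree Cs k (d ∷ p)
    inTreeʳ : ∀ k d p → LeafOf λ' (cr k (d ∷ p)) → InTree Cs k (flip (d ∷ p))
    coh     : ∀ k C d p e q → nth Cs k ≡ just C
            → LeafOf λ' (cl k (d ∷ p)) → LeafOf λ' (cr k (e ∷ q)) → Coh C (d ∷ p) (flip (e ∷ q))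
open Coherent

coherent-anti : ∀ {Cs λ' μ} → (∀ {a} → LeafOf μ a → LeafOf λ' a) → Coherent Cs λ' → Coherent Cs μ
coherent-anti ⊆λ I .inTreeˡ k d p l = inTreeˡ I k d p (⊆λ l)
coherent-anti ⊆λ I .inTreeʳ k d p l = inTreeʳ I k d p (⊆λ l)
coherent-anti ⊆λ I .coh k C d p e q eq l l′ = coh I k C d p e q eq (⊆λ l) (⊆λ l′)

reindex-cl⁻ : ∀ r a {k p} → reindexCuts r a ≡ cl k p → Σ ℕ λ k₀ → a ≡ cl k₀ p × r k₀ ≡ k
reindex-cl⁻ r (cl k₀ p) refl = k₀ , refl , refl

reindex-cr⁻ : ∀ r a {k p} → reindexCuts r a ≡ cr k p → Σ ℕ λ k₀ → a ≡ cr k₀ p × r k₀ ≡ k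
reindex-cr⁻ r (cr k₀ p) refl = k₀ , refl , refl

leaf-reindex-cl⁻ : ∀ r {λ' k p} → LeafOf (mapLinking (reindexCuts r) λ') (cl k p)
  → Σ ℕ λ k₀ → LeafOf λ' (cl k₀ p) × r k₀ ≡ k
leaf-reindex-cl⁻ r l with leaf-map⁻ _ l
... | a , la , eq with reindex-cl⁻ r a eq
... | k₀ , refl , rk = k₀ , la , rk

leaf-reindex-cr⁻ : ∀ r {λ' k p} → LeafOf (mapLinking (reindexCuts r) λ') (cr k p)
  → Σ ℕ λ k₀ → LeafOf λ' (cr k₀ p) × r k₀ ≡ k
leaf-reindex-cr⁻ r l with leaf-map⁻ _ l
... | a , la , eq with reindex-cr⁻ r a eq
... | k₀ , refl , rk = k₀ , la , rk

-- Coherence constrains only pairs with leaves below a root. It is therefore enough that `r` is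
-- injective and preserves formulas on a set `Live` containing these pairs; removal of an atomic cut
-- and garbage collection are both of this kind.
coherent-reindex : ∀ {Cs Ds λ'} r (Live : ℕ → Set)
  → (∀ k d p → LeafOf λ' (cl k (d ∷ p)) → Live k)
  → (∀ k d p → LeafOf λ' (cr k (d ∷ p)) → Live k)
  → (∀ k {C} → Live k → nth Cs k ≡ just C → nth Ds (r k) ≡ just C)
  → (∀ k k′ → Live k → Live k′ → r k ≡ r k′ → k ≡ k′)
  → Coherent Cs λ' → Coherent Ds (mapLinking (reindexCuts r) λ')
coherent-reindex r Live liveˡ liveʳ keep inj I .inTreeˡ k d p l with leaf-reindex-cl⁻ r l
... | k₀ , l₀ , refl with inTreeˡ I k₀ d p l₀
... | C , eq , C∋ = C , keep k₀ (liveˡ k₀ d p l₀) eq , C∋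
coherent-reindex r Live liveˡ liveʳ keep inj I .inTreeʳ k d p l with leaf-reindex-cr⁻ r l
... | k₀ , l₀ , refl with inTreeʳ I k₀ d p l₀
... | C , eq , C∋ = C , keep k₀ (liveʳ k₀ d p l₀) eq , C∋
coherent-reindex r Live liveˡ liveʳ keep inj I .coh k C d p e q eqC l l′
  with leaf-reindex-cl⁻ r l | leaf-reindex-cr⁻ r l′
... | k₀ , l₀ , refl | k₁ , l₁ , rk₁
  with inj k₁ k₀ (liveʳ k₁ e q l₁) (liveˡ k₀ d p l₀) rk₁ | inTreeˡ I k₀ d p l₀
... | refl | C₀ , eq₀ , _ with trans (sym (keep k₀ (liveˡ k₀ d p l₀) eq₀)) eqC
... | refl = coh I k₀ C d p e q eq₀ l₀ l₁

-- Atomic cuts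

dropIndex : ℕ → ℕ → ℕ
dropIndex i k = if i <ᵇ k then k ∸ 1 else k

dropIndex-suc : ∀ i k → dropIndex (suc i) (suc k) ≡ suc (dropIndex i k)
dropIndex-suc i zero = refl
dropIndex-suc i (suc k) with i <ᵇ suc k
... | true  = refl
... | false = refl

-- The indices `i` and `suc i` are both sent to `i`, which is why `i` is excluded.
dropIndex-injective : ∀ i k k′ → k ≢ i → k′ ≢ i → dropIndex i k ≡ dropIndex i k′ → k ≡ k′
dropIndex-injective zero    zero    _        k≢ _   _  = ⊥-elim (k≢ refl)
dropIndex-injective zero    (suc _) zero     _  k≢′ _  = ⊥-elim (k≢′ refl)
dropIndex-injective zero    (suc k) (suc k′) _  _   eq = cong suc eq
dropIndex-injective (suc i) zero    zero     _  _   _  = refl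
dropIndex-injective (suc i) zero    (suc k′) _  _   eq with trans eq (dropIndex-suc i k′)
... | ()
dropIndex-injective (suc i) (suc k) zero     _  _   eq with trans (sym (dropIndex-suc i k)) eq
... | ()
dropIndex-injective (suc i) (suc k) (suc k′) k≢ k≢′ eq =
  cong suc (dropIndex-injective i k k′ (k≢ ∘ cong suc) (k≢′ ∘ cong suc)
    (suc-injective (trans (sym (dropIndex-suc i k)) (trans eq (dropIndex-suc i k′)))))

nth-removeAt : ∀ (Cs : List Fm) i k → k ≢ i → nth (removeAtℕ Cs i) (dropIndex i k) ≡ nth Cs k
nth-removeAt []       i       k       _  = refl
nth-removeAt (C ∷ Cs) zero    zero    k≢ = ⊥-elim (k≢ refl)
nth-removeAt (C ∷ Cs) zero    (suc k) _  = refl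
nth-removeAt (C ∷ Cs) (suc i) zero    _  = refl
nth-removeAt (C ∷ Cs) (suc i) (suc k) k≢ =
  trans (cong (nth (C ∷ removeAtℕ Cs i)) (dropIndex-suc i k)) (nth-removeAt Cs i k (k≢ ∘ cong suc))

-- An atomic formula has no vertex below its root, so `inTreeˡ` and `inTreeʳ` keep every leaf below
-- a root out of the removed pair.
coherent-drop : ∀ {Cs i C λ'} → nth Cs i ≡ just C → (∀ d p → sub C (d ∷ p) ≡ nothing)
  → Coherent Cs λ' → Coherent (removeAtℕ Cs i) (mapLinking (dropCut i) λ')
coherent-drop {Cs} {i} {C} eqC at I = coherent-reindex (dropIndex i) (_≢ i)
  (λ k d p l → live d p (inTreeˡ I k d p l))
  (λ k d p l → live (opp d) (flip p) (inTreeʳ I k d p l))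
  (λ k k≢ eq → trans (nth-removeAt Cs i k k≢) eq)
  (dropIndex-injective i) I
  where
  live : ∀ {k} d p → InTree Cs k (d ∷ p) → k ≢ i
  live d p (C′ , eq , C′∋) refl with trans (sym eqC) eq
  ... | refl = C′∋ (at d p)

-- Both ends of a merged link are ends of links of `λ'`.
mergePos-⊆ : ∀ i λ' {a} → LeafOf (mergePos i λ') a → LeafOf λ' a
mergePos-⊆ i λ' (ℓ , ℓ∈ , occ) with ∈-++⁻ (filterᵇ (λ ℓ → not (touches i ℓ)) λ') ℓ∈
... | inj₁ ℓ∈₁ = ℓ , proj₁ (∈-filter⁻ (T? ∘ (λ ℓ → not (touches i ℓ))) ℓ∈₁) , occ
... | inj₂ ℓ∈₂ with ∈-pairs⁻ _,_ (concatMap (λ ℓ → if isCR0 i (proj₂ ℓ) then proj₁ ℓ ∷ [] else []) λ') _ ℓ∈₂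
... | m , l , m∈ , l∈ , refl
  with ∈-select⁻ (isCR0 i ∘ proj₂) proj₁ λ' m∈ | ∈-select⁻ (isCL0 i ∘ proj₁) proj₂ λ' l∈
mergePos-⊆ i λ' (ℓ , ℓ∈ , inj₁ refl) | inj₂ _ | m , l , _ , _ , refl | _ , ℓ₁∈ , refl | _ = leaf₁ ℓ₁∈
mergePos-⊆ i λ' (ℓ , ℓ∈ , inj₂ refl) | inj₂ _ | m , l , _ , _ , refl | _ | _ , ℓ₂∈ , refl = leaf₂ ℓ₂∈

mergeNeg-⊆ : ∀ i λ' {a} → LeafOf (mergeNeg i λ') a → LeafOf λ' a
mergeNeg-⊆ i λ' (ℓ , ℓ∈ , occ) with ∈-++⁻ (filterᵇ (λ ℓ → not (touches i ℓ)) λ') ℓ∈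
... | inj₁ ℓ∈₁ = ℓ , proj₁ (∈-filter⁻ (T? ∘ (λ ℓ → not (touches i ℓ))) ℓ∈₁) , occ
... | inj₂ ℓ∈₂ with ∈-pairs⁻ _,_ (concatMap (λ ℓ → if isCL0 i (proj₂ ℓ) then proj₁ ℓ ∷ [] else []) λ') _ ℓ∈₂
... | l , m , l∈ , m∈ , refl
  with ∈-select⁻ (isCL0 i ∘ proj₂) proj₁ λ' l∈ | ∈-select⁻ (isCR0 i ∘ proj₁) proj₂ λ' m∈
mergeNeg-⊆ i λ' (ℓ , ℓ∈ , inj₁ refl) | inj₂ _ | l , m , _ , _ , refl | _ , ℓ₁∈ , refl | _ = leaf₁ ℓ₁∈
mergeNeg-⊆ i λ' (ℓ , ℓ∈ , inj₂ refl) | inj₂ _ | l , m , _ , _ , refl | _ | _ , ℓ₂∈ , refl = leaf₂ ℓ₂∈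

-- Garbage collection of cut pairs

rank-mono : ∀ u j m → rank u j ≤ rank u (j + m)
rank-mono u j zero    = ≤-reflexive (cong (rank u) (sym (+-identityʳ j)))
rank-mono u j (suc m) = ≤-trans (rank-mono u j m)
  (≤-trans (m≤m+n (rank u (j + m)) _) (≤-reflexive (cong (rank u) (sym (+-suc j m)))))

rank-< : ∀ u {k k′} → T (u k) → k < k′ → rank u k < rank u k′
rank-< u {k} uk k<k′ with m≤n⇒∃[o]m+o≡n k<k′
... | m , refl = ≤-trans (≤-reflexive (rank-suc uk)) (rank-mono u (suc k) m)
  where
  rank-suc : T (u k) → suc (rank u k) ≡ rank u (suc k)
  rank-suc uk with u k
  ... | true = +-comm 1 (rank u k)

rank-injective : ∀ u k k′ → T (u k) → T (u k′) → rank u k ≡ rank u k′ → k ≡ k′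
rank-injective u k k′ uk uk′ eq with <-cmp k k′
... | tri< k<k′ _ _ = ⊥-elim (<⇒≢ (rank-< u uk k<k′) eq)
... | tri≈ _ k≡k′ _ = k≡k′
... | tri> _ _ k′<k = ⊥-elim (<⇒≢ (rank-< u uk′ k′<k) (sym eq))

-- Generalised over the start `j` of the count for the induction on `Cs`: the new position `t` is
-- the number of used indices from `j` up to, but excluding, `j + m`.
nth-keepCuts : ∀ u j Cs m {C} → T (u (j + m)) → nth Cs m ≡ just C
  → Σ ℕ λ t → rank u (j + m) ≡ rank u j + t × nth (keepCuts u j Cs) t ≡ just C
nth-keepCuts u j (C ∷ Cs) zero ut refl =
  0 , trans (cong (rank u) (+-identityʳ j)) (sym (+-identityʳ (rank u j))) , first
  where
  first : nth (keepCuts u j (C ∷ Cs)) 0 ≡ just C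
  first with u j | subst (T ∘ u) (+-identityʳ j) ut
  ... | true | _ = refl
nth-keepCuts u j (C ∷ Cs) (suc m) ut eq
  with u j | nth-keepCuts u (suc j) Cs m (subst (T ∘ u) (+-suc j m) ut) eq
... | true  | t , rk , eq′ = suc t , trans (cong (rank u) (+-suc j m)) (trans rk (+-assoc (rank u j) 1 t)) , eq′
... | false | t , rk , eq′ = t , trans (cong (rank u) (+-suc j m)) (trans rk (+-assoc (rank u j) 0 t)) , eq′

leaf-used : ∀ {θ λ' a} k → λ' ∈ θ → LeafOf λ' a → T (inCutᵇ k a) → T (used θ k)
leaf-used k λ∈ l t = any⁺ _ (lose λ∈ (anyLeaf⁺ (inCutᵇ k) l t))

coherent-gc : ∀ {Cs θ λ'} → λ' ∈ θ → Coherent Cs λ'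
  → Coherent (keepCuts (used θ) 0 Cs) (mapLinking (reindexCuts (rank (used θ))) λ')
coherent-gc {Cs} {θ} λ∈ = coherent-reindex (rank (used θ)) (T ∘ used θ)
  (λ k d p l → leaf-used k λ∈ l (≡⇒≡ᵇ k k refl))
  (λ k d p l → leaf-used k λ∈ l (≡⇒≡ᵇ k k refl))
  keep (rank-injective (used θ))
  where
  keep : ∀ k {C} → T (used θ k) → nth Cs k ≡ just C
    → nth (keepCuts (used θ) 0 Cs) (rank (used θ) k) ≡ just C
  keep k uk eq with nth-keepCuts (used θ) 0 Cs k uk eq
  ... | t , rk , eq′ = trans (cong (nth (keepCuts (used θ) 0 Cs)) rk) eq′

-- Splitting a cut pair

module _ (i n : ℕ) where

  -- A vertex below a root comes from the first argument of pair `i`, from its second argument, or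
  -- from another pair. The last alternative still allows `k ≡ n`; `coherent-split` rules this out
  -- by the bound on the leaves.
  split-cl⁻ : ∀ a {k d p} → splitAddr i n a ≡ cl k (d ∷ p)
    → (a ≡ cl i (L ∷ d ∷ p) × k ≡ i) ⊎ (a ≡ cl i (R ∷ d ∷ p) × k ≡ n) ⊎ (a ≡ cl k (d ∷ p) × k ≢ i)
  split-cl⁻ (cl k (L ∷ p)) eq with k ≡ᵇ i in k≡ᵇi
  split-cl⁻ (cl k (L ∷ p)) refl | true with ≡ᵇ⇒≡ k i (Equivalence.from T-≡ k≡ᵇi)
  ... | refl = inj₁ (refl , refl)
  split-cl⁻ (cl k (L ∷ p)) refl | false =
    inj₂ (inj₂ (refl , λ { refl → subst T k≡ᵇi (≡⇒≡ᵇ k k refl) }))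
  split-cl⁻ (cl k (R ∷ p)) eq with k ≡ᵇ i in k≡ᵇi
  split-cl⁻ (cl k (R ∷ p)) refl | true with ≡ᵇ⇒≡ k i (Equivalence.from T-≡ k≡ᵇi)
  ... | refl = inj₂ (inj₁ (refl , refl))
  split-cl⁻ (cl k (R ∷ p)) refl | false =
    inj₂ (inj₂ (refl , λ { refl → subst T k≡ᵇi (≡⇒≡ᵇ k k refl) }))
  split-cl⁻ (cr k (L ∷ p)) eq with k ≡ᵇ i
  split-cl⁻ (cr k (L ∷ p)) () | true
  split-cl⁻ (cr k (L ∷ p)) () | false
  split-cl⁻ (cr k (R ∷ p)) eq with k ≡ᵇ i
  split-cl⁻ (cr k (R ∷ p)) () | true
  split-cl⁻ (cr k (R ∷ p)) () | false

  split-cr⁻ : ∀ a {k d p} → splitAddr i n a ≡ cr k (d ∷ p)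
    → (a ≡ cr i (R ∷ d ∷ p) × k ≡ i) ⊎ (a ≡ cr i (L ∷ d ∷ p) × k ≡ n) ⊎ (a ≡ cr k (d ∷ p) × k ≢ i)
  split-cr⁻ (cr k (R ∷ p)) eq with k ≡ᵇ i in k≡ᵇi
  split-cr⁻ (cr k (R ∷ p)) refl | true with ≡ᵇ⇒≡ k i (Equivalence.from T-≡ k≡ᵇi)
  ... | refl = inj₁ (refl , refl)
  split-cr⁻ (cr k (R ∷ p)) refl | false =
    inj₂ (inj₂ (refl , λ { refl → subst T k≡ᵇi (≡⇒≡ᵇ k k refl) }))
  split-cr⁻ (cr k (L ∷ p)) eq with k ≡ᵇ i in k≡ᵇi
  split-cr⁻ (cr k (L ∷ p)) refl | true with ≡ᵇ⇒≡ k i (Equivalence.from T-≡ k≡ᵇi)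
  ... | refl = inj₂ (inj₁ (refl , refl))
  split-cr⁻ (cr k (L ∷ p)) refl | false =
    inj₂ (inj₂ (refl , λ { refl → subst T k≡ᵇi (≡⇒≡ᵇ k k refl) }))
  split-cr⁻ (cl k (L ∷ p)) eq with k ≡ᵇ i
  split-cr⁻ (cl k (L ∷ p)) () | true
  split-cr⁻ (cl k (L ∷ p)) () | false
  split-cr⁻ (cl k (R ∷ p)) eq with k ≡ᵇ i
  split-cr⁻ (cl k (R ∷ p)) () | true
  split-cr⁻ (cl k (R ∷ p)) () | false

  split-gv⁻ : ∀ a {j p} → splitAddr i n a ≡ gv j p → a ≡ gv j p
  split-gv⁻ (gv j p)       eq = eq
  split-gv⁻ (cl k (L ∷ p)) eq with k ≡ᵇ i
  split-gv⁻ (cl k (L ∷ p)) () | true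
  split-gv⁻ (cl k (L ∷ p)) () | false
  split-gv⁻ (cl k (R ∷ p)) eq with k ≡ᵇ i
  split-gv⁻ (cl k (R ∷ p)) () | true
  split-gv⁻ (cl k (R ∷ p)) () | false
  split-gv⁻ (cr k (L ∷ p)) eq with k ≡ᵇ i
  split-gv⁻ (cr k (L ∷ p)) () | true
  split-gv⁻ (cr k (L ∷ p)) () | false
  split-gv⁻ (cr k (R ∷ p)) eq with k ≡ᵇ i
  split-gv⁻ (cr k (R ∷ p)) () | true
  split-gv⁻ (cr k (R ∷ p)) () | false

splitCuts : List Fm → ℕ → Fm → Fm → List Fm
splitCuts Cs i D E = setAtℕ Cs i D ++ E ∷ []

nth-splitCuts-≡ : ∀ Cs i {C D E} → nth Cs i ≡ just C → nth (splitCuts Cs i D E) i ≡ just D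
nth-splitCuts-≡ (_ ∷ Cs) zero    eq = refl
nth-splitCuts-≡ (_ ∷ Cs) (suc i) eq = nth-splitCuts-≡ Cs i eq

nth-splitCuts-length : ∀ Cs i {C D E} → nth Cs i ≡ just C
  → nth (splitCuts Cs i D E) (length Cs) ≡ just E
nth-splitCuts-length (_ ∷ Cs) (suc i) eq = nth-splitCuts-length Cs i eq
nth-splitCuts-length (_ ∷ Cs) zero {D = D} {E} _ = last Cs
  where
  last : ∀ Cs → nth (Cs ++ E ∷ []) (length Cs) ≡ just E
  last []       = refl
  last (_ ∷ Cs) = last Cs

nth-splitCuts-≢ : ∀ Cs i k {C D E} → k ≢ i → nth Cs k ≡ just C → nth (splitCuts Cs i D E) k ≡ just C
nth-splitCuts-≢ (_ ∷ Cs) zero    zero    k≢ _  = ⊥-elim (k≢ refl)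
nth-splitCuts-≢ (_ ∷ Cs) (suc i) zero    _  eq = eq
nth-splitCuts-≢ (_ ∷ Cs) (suc i) (suc k) k≢ eq = nth-splitCuts-≢ Cs i k (k≢ ∘ cong suc) eq
nth-splitCuts-≢ (_ ∷ Cs) zero    (suc k) _  eq = init Cs k eq
  where
  init : ∀ Cs k {C E} → nth Cs k ≡ just C → nth (Cs ++ E ∷ []) k ≡ just C
  init (_ ∷ Cs) zero    eq = eq
  init (_ ∷ Cs) (suc k) eq = init Cs k eq

nth-length : ∀ (Cs : List Fm) {C} → nth Cs (length Cs) ≢ just C
nth-length (_ ∷ Cs) eq = nth-length Cs eq

coh-arg : ∀ {C D} b {p q} → (∀ r → sub C (b ∷ r) ≡ sub D r) → Coh C (b ∷ p) (b ∷ q) → Coh D p q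
coh-arg b arg h r d e s t eqp eqq add =
  h (b ∷ r) d e s t (cong (b ∷_) eqp) (cong (b ∷_) eqq) (subst Additive (sym (arg r)) add)

module _ {Cs i C D E λ'} (eqC : nth Cs i ≡ just C)
  (argL : ∀ r → sub C (L ∷ r) ≡ sub D r) (argR : ∀ r → sub C (R ∷ r) ≡ sub E r)
  (I : Coherent Cs λ') where

  private
    Ds = splitCuts Cs i D E
    n  = length Cs

    at-i : nth Ds i ≡ just D
    at-i = nth-splitCuts-≡ Cs i eqC

    at-n : nth Ds n ≡ just E
    at-n = nth-splitCuts-length Cs i eqC

    inTree-i : ∀ p → InTree Cs i (L ∷ p) → InTree Ds i p
    inTree-i p (C′ , eq , C′∋) with trans (sym eqC) eq
    ... | refl = D , at-i , C′∋ ∘ trans (argL p)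

    inTree-n : ∀ p → InTree Cs i (R ∷ p) → InTree Ds n p
    inTree-n p (C′ , eq , C′∋) with trans (sym eqC) eq
    ... | refl = E , at-n , C′∋ ∘ trans (argR p)

    inTree-k : ∀ {k} p → k ≢ i → InTree Cs k p → InTree Ds k p
    inTree-k {k} p k≢ (C′ , eq , C′∋) = C′ , nth-splitCuts-≢ Cs i k k≢ eq , C′∋

    i≢n : i ≢ n
    i≢n refl = nth-length Cs eqC

    tree≢n : ∀ {k} p → InTree Cs k p → k ≢ n
    tree≢n _ (_ , eq , _) refl = nth-length Cs eq

  -- Two leaves facing each other in a new pair faced each other in pair `i`, with the same first
  -- step after `flip`; removing this common step preserves coherence.
  coherent-split : Coherent Ds (mapLinking (splitAddr i n) λ')
  coherent-split .inTreeˡ k d p l with leaf-map⁻ _ l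
  ... | a , la , eq with split-cl⁻ i n a eq
  ... | inj₁ (refl , refl)        = inTree-i (d ∷ p) (inTreeˡ I i L (d ∷ p) la)
  ... | inj₂ (inj₁ (refl , refl)) = inTree-n (d ∷ p) (inTreeˡ I i R (d ∷ p) la)
  ... | inj₂ (inj₂ (refl , k≢))   = inTree-k (d ∷ p) k≢ (inTreeˡ I k d p la)
  coherent-split .inTreeʳ k d p l with leaf-map⁻ _ l
  ... | a , la , eq with split-cr⁻ i n a eq
  ... | inj₁ (refl , refl)        = inTree-i (flip (d ∷ p)) (inTreeʳ I i R (d ∷ p) la)
  ... | inj₂ (inj₁ (refl , refl)) = inTree-n (flip (d ∷ p)) (inTreeʳ I i L (d ∷ p) la)
  ... | inj₂ (inj₂ (refl , k≢))   = inTree-k (flip (d ∷ p)) k≢ (inTreeʳ I k d p la)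
  coherent-split .coh k X d p e q eqX l l′ with leaf-map⁻ _ l | leaf-map⁻ _ l′
  ... | a , la , eqa | b , lb , eqb with split-cl⁻ i n a eqa | split-cr⁻ i n b eqb
  ... | inj₁ (refl , refl) | inj₁ (refl , _) with trans (sym at-i) eqX
  ...   | refl = coh-arg L argL (coh I i C L (d ∷ p) R (e ∷ q) eqC la lb)
  coherent-split .coh k X d p e q eqX l l′ | a , la , eqa | b , lb , eqb
      | inj₂ (inj₁ (refl , refl)) | inj₂ (inj₁ (refl , _)) with trans (sym at-n) eqX
  ...   | refl = coh-arg R argR (coh I i C R (d ∷ p) L (e ∷ q) eqC la lb)
  -- For an untouched pair, `inTreeˡ` supplies its formula in the old list, and this formula has to
  -- be `X`.
  coherent-split .coh k X d p e q eqX l l′ | a , la , eqa | b , lb , eqb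
      | inj₂ (inj₂ (refl , k≢)) | inj₂ (inj₂ (refl , _)) with inTreeˡ I k d p la
  ...   | X₀ , eqX₀ , _ with trans (sym (nth-splitCuts-≢ Cs i k k≢ eqX₀)) eqX
  ...   | refl = coh I k X d p e q eqX₀ la lb
  -- The remaining cases place the two leaves in different new pairs: `i` and `n` differ, and no old
  -- pair has index `n`.
  coherent-split .coh k X d p e q eqX l l′ | a , la , eqa | b , lb , eqb
      | inj₁ (refl , k≡i) | inj₂ (inj₁ (refl , k≡n)) = ⊥-elim (i≢n (trans (sym k≡i) k≡n))
  coherent-split .coh k X d p e q eqX l l′ | a , la , eqa | b , lb , eqb
      | inj₁ (refl , k≡i) | inj₂ (inj₂ (refl , k≢i)) = ⊥-elim (k≢i k≡i)
  coherent-split .coh k X d p e q eqX l l′ | a , la , eqa | b , lb , eqb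
      | inj₂ (inj₁ (refl , k≡n)) | inj₁ (refl , k≡i) = ⊥-elim (i≢n (trans (sym k≡i) k≡n))
  coherent-split .coh k X d p e q eqX l l′ | a , la , eqa | b , lb , eqb
      | inj₂ (inj₁ (refl , k≡n)) | inj₂ (inj₂ (refl , _)) = ⊥-elim (tree≢n (flip (e ∷ q)) (inTreeʳ I k e q lb) k≡n)
  coherent-split .coh k X d p e q eqX l l′ | a , la , eqa | b , lb , eqb
      | inj₂ (inj₂ (refl , k≢i)) | inj₁ (refl , k≡i) = ⊥-elim (k≢i k≡i)
  coherent-split .coh k X d p e q eqX l l′ | a , la , eqa | b , lb , eqb
      | inj₂ (inj₂ (refl , _)) | inj₂ (inj₁ (refl , k≡n)) = ⊥-elim (tree≢n (d ∷ p) (inTreeˡ I k d p la) k≡n)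

-- Additive cuts keep coherent linkings

dirEq⇒≡ : ∀ d e → T (dirEq d e) → d ≡ e
dirEq⇒≡ L L _ = refl
dirEq⇒≡ R R _ = refl

underCL⁻ : ∀ i d a → T (underCL i d a) → Σ Path λ p → a ≡ cl i (d ∷ p)
underCL⁻ i d (cl k (e ∷ p)) t with Equivalence.to T-∧ t
... | tk , td with ≡ᵇ⇒≡ k i tk | dirEq⇒≡ d e td
... | refl | refl = p , refl

underCR⁻ : ∀ i d a → T (underCR i d a) → Σ Path λ p → a ≡ cr i (d ∷ p)
underCR⁻ i d (cr k (e ∷ p)) t with Equivalence.to T-∧ t
... | tk , td with ≡ᵇ⇒≡ k i tk | dirEq⇒≡ d e td
... | refl | refl = p , refl

-- Non-dual choices mean leaves under the same direction `d` on both sides. After `flip` one path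
-- starts with `d` and the other with `opp d`, so they part at the additive root.
coherent⇒dual : ∀ {Cs i C λ'} → nth Cs i ≡ just C → Additive (just C) → Coherent Cs λ'
  → ¬ T (nonDual i λ')
coherent⇒dual {i = i} {C} {λ'} eqC add I t = [ clash L , clash R ]′ (Equivalence.to T-∨ t)
  where
  clash : ∀ d → ¬ T (anyLeaf (underCL i d) λ' ∧ anyLeaf (underCR i d) λ')
  clash d t′ with Equivalence.to (T-∧ {anyLeaf (underCL i d) λ'}) t′
  ... | tl , tr with anyLeaf⁻ (underCL i d) λ' tl | anyLeaf⁻ (underCR i d) λ' tr
  ... | a , la , ta | b , lb , tb with underCL⁻ i d a ta | underCR⁻ i d b tb
  ... | p , refl | q , refl = d≢opp d (coh I i C d p d q eqC la lb [] d (opp d) p (flip q) refl refl add)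
    where
    d≢opp : ∀ d → d ≢ opp d
    d≢opp L ()
    d≢opp R ()

¬T⇒T-not : ∀ b → ¬ T b → T (not b)
¬T⇒T-not false _ = tt
¬T⇒T-not true  h = h tt

-- Links and leaves of conclusions along a reduction

_⊴_ : Linking → Linking → Set
λ' ⊴ μ = ∀ {j k p q} → (gv j p , gv k q) ∈ λ' → (gv j p , gv k q) ∈ μ

_⊑_ : Linking → Linking → Set
μ ⊑ λ' = ∀ j p → LeafOf μ (gv j p) → LeafOf λ' (gv j p)

-- Steps rename only addresses in cut pairs, so a link between conclusions is mapped to itself.
⊴-reindex : ∀ r λ' → λ' ⊴ mapLinking (reindexCuts r) λ'
⊴-reindex r λ' ℓ∈ = ∈-map⁺ _ ℓ∈

⊴-split : ∀ i n λ' → λ' ⊴ mapLinking (splitAddr i n) λ'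
⊴-split i n λ' ℓ∈ = ∈-map⁺ _ ℓ∈

-- A link between conclusions touches no cut, so the filter test computes to `true`.
⊴-mergePos : ∀ i λ' → λ' ⊴ mergePos i λ'
⊴-mergePos i λ' ℓ∈ = ∈-++⁺ˡ (∈-filter⁺ (T? ∘ (λ ℓ → not (touches i ℓ))) ℓ∈ tt)

⊴-mergeNeg : ∀ i λ' → λ' ⊴ mergeNeg i λ'
⊴-mergeNeg i λ' ℓ∈ = ∈-++⁺ˡ (∈-filter⁺ (T? ∘ (λ ℓ → not (touches i ℓ))) ℓ∈ tt)

⊑-reindex : ∀ r λ' → mapLinking (reindexCuts r) λ' ⊑ λ'
⊑-reindex r λ' j p l with leaf-map⁻ _ l
... | gv _ _ , la , refl = la

⊑-split : ∀ i n λ' → mapLinking (splitAddr i n) λ' ⊑ λ'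
⊑-split i n λ' j p l with leaf-map⁻ _ l
... | a , la , eq with split-gv⁻ i n a eq
... | refl = la

Survives : Linking → List Fm → Net → Set
Survives λ' Cs θ = Σ Linking λ μ → μ ∈ θ × Coherent Cs μ × λ' ⊴ μ

survives-split : ∀ {Cs θ i C D E λ'} → nth Cs i ≡ just C
  → (∀ r → sub C (L ∷ r) ≡ sub D r) → (∀ r → sub C (R ∷ r) ≡ sub E r)
  → λ' ∈ θ → Coherent Cs λ'
  → Survives λ' (splitCuts Cs i D E) (mapNet (splitAddr i (length Cs)) θ)
survives-split {Cs} {i = i} {λ' = λ'} eqC argL argR λ∈ I =
  _ , ∈-map⁺ _ λ∈ , coherent-split eqC argL argR I , ⊴-split i (length Cs) λ'

survives-gc : ∀ {Cs θ λ'} → Survives λ' Cs θ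
  → Survives λ' (keepCuts (used θ) 0 Cs) (mapNet (reindexCuts (rank (used θ))) θ)
survives-gc {θ = θ} (μ , μ∈ , I , keep) =
  _ , ∈-map⁺ _ μ∈ , coherent-gc μ∈ I , ⊴-reindex (rank (used θ)) μ ∘ keep

dual-kept : ∀ {Cs i C θ λ'} → nth Cs i ≡ just C → Additive (just C) → λ' ∈ θ → Coherent Cs λ'
  → λ' ∈ filterᵇ (λ λ' → not (nonDual i λ')) θ
dual-kept {i = i} eqC add λ∈ I =
  ∈-filter⁺ (T? ∘ (λ λ' → not (nonDual i λ'))) λ∈ (¬T⇒T-not _ (coherent⇒dual eqC add I))

-- Only the step for an additive cut deletes linkings, and `dual-kept` protects the coherent ones.
-- Coherence of the image is part of the result, so that steps can be iterated.
survives-step : ∀ {st st'} λ' → st ⟶ st' → λ' ∈ proj₂ st → Coherent (cuts (proj₁ st)) λ'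
  → Survives λ' (cuts (proj₁ st')) (proj₂ st')
survives-step {S , θ} λ' (step i eq) λ∈ I with nth (cuts S) i in eqC | eq
... | just (pos x) | refl =
  _ , ∈-map⁺ _ (∈-map⁺ _ λ∈)
  , coherent-drop eqC (λ _ _ → refl) (coherent-anti (mergePos-⊆ i λ') I)
  , ⊴-reindex (dropIndex i) _ ∘ ⊴-mergePos i λ'
... | just (neg x) | refl =
  _ , ∈-map⁺ _ (∈-map⁺ _ λ∈)
  , coherent-drop eqC (λ _ _ → refl) (coherent-anti (mergeNeg-⊆ i λ') I)
  , ⊴-reindex (dropIndex i) _ ∘ ⊴-mergeNeg i λ'
... | just (D ⊗ E) | refl = survives-split eqC (λ _ → refl) (λ _ → refl) λ∈ I
... | just (D ⅋ E) | refl = survives-split eqC (λ _ → refl) (λ _ → refl) λ∈ I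
... | just (D & E) | refl =
  survives-gc (survives-split eqC (λ _ → refl) (λ _ → refl) (dual-kept eqC with′ λ∈ I) I)
... | just (D ⊕ E) | refl =
  survives-gc (survives-split eqC (λ _ → refl) (λ _ → refl) (dual-kept eqC plus′ λ∈ I) I)

survives : ∀ {st st'} λ' → st ⟶* st' → λ' ∈ proj₂ st → Coherent (cuts (proj₁ st)) λ'
  → Survives λ' (cuts (proj₁ st')) (proj₂ st')
survives λ' ε        λ∈ I = λ' , λ∈ , I , λ ℓ∈ → ℓ∈
survives λ' (s ◅ ss) λ∈ I with survives-step λ' s λ∈ I
... | μ , μ∈ , J , keep with survives μ ss μ∈ J
... | ν , ν∈ , K , keep′ = ν , ν∈ , K , keep′ ∘ keep

⊑-trans : ∀ {λ' μ ν} → ν ⊑ μ → μ ⊑ λ' → ν ⊑ λ'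
⊑-trans ν⊑μ μ⊑λ j p l = μ⊑λ j p (ν⊑μ j p l)

Originates : Linking → Net → Set
Originates ν θ = Σ Linking λ λ' → λ' ∈ θ × ν ⊑ λ'

originates-map : ∀ {h : Linking → Linking} {θ ν} → (∀ λ' → h λ' ⊑ λ')
  → Originates ν (map h θ) → Originates ν θ
originates-map {h} h⊑ (μ , μ∈ , ν⊑μ) with ∈-map⁻ h μ∈
... | λ' , λ∈ , refl = λ' , λ∈ , ⊑-trans ν⊑μ (h⊑ λ')

originates-filter : ∀ P {θ ν} → Originates ν (filterᵇ P θ) → Originates ν θ
originates-filter P (μ , μ∈ , ν⊑μ) = μ , proj₁ (∈-filter⁻ (T? ∘ P) μ∈) , ν⊑μ

originates-splitAdd : ∀ S θ i D E {ν} → Originates ν (proj₂ (splitAdd (S , θ) i D E)) → Originates ν θ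
originates-splitAdd S θ i D E =
  originates-filter (λ λ' → not (nonDual i λ'))
  ∘ originates-map (⊑-split i (length (cuts S)))
  ∘ originates-map (⊑-reindex _)

-- Each linking after a step is the image of one before it, and no step adds leaves in the
-- conclusions.
originates-step : ∀ {st st' ν} → st ⟶ st' → Originates ν (proj₂ st') → Originates ν (proj₂ st)
originates-step {S , θ} (step i eq) with nth (cuts S) i | eq
... | just (pos x) | refl = originates-map (λ λ' j p → mergePos-⊆ i λ')
                          ∘ originates-map (⊑-reindex (dropIndex i))
... | just (neg x) | refl = originates-map (λ λ' j p → mergeNeg-⊆ i λ')
                          ∘ originates-map (⊑-reindex (dropIndex i))
... | just (D ⊗ E) | refl = originates-map (⊑-split i (length (cuts S)))
... | just (D ⅋ E) | refl = originates-map (⊑-split i (length (cuts S)))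
... | just (D & E) | refl = originates-splitAdd S θ i D E
... | just (D ⊕ E) | refl = originates-splitAdd S θ i D E

originates : ∀ {st st' ν} → st ⟶* st' → Originates ν (proj₂ st') → Originates ν (proj₂ st)
originates ε        o = o
originates (s ◅ ss) o = originates-step s (originates ss o)

-- Linkings on cut-free sequents

leaf-label : ∀ {Γ λ' a} → IsLinking (cutFree Γ) λ' → LeafOf λ' a → IsLeaf (cutFree Γ) a
leaf-label (links , _) (ℓ , ℓ∈ , occ) with lookupAll links ℓ∈
leaf-label (links , _) (ℓ , ℓ∈ , inj₁ refl) | x , eq , _ = x , inj₁ eq
leaf-label (links , _) (ℓ , ℓ∈ , inj₂ refl) | x , _ , eq = x , inj₂ eq

gv-atomic : ∀ Γ j {D} p → nth Γ j ≡ just D → IsLeaf (cutFree Γ) (gv j p) → Atomic (sub D p)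
gv-atomic Γ j {D} p eq leaf rewrite eq with sub D p | leaf
... | just (pos x) | _ = x , inj₁ refl
... | just (neg x) | _ = x , inj₂ refl
... | just (_ ⊗ _) | _ , inj₁ ()
... | just (_ ⊗ _) | _ , inj₂ ()
... | just (_ ⅋ _) | _ , inj₁ ()
... | just (_ ⅋ _) | _ , inj₂ ()
... | just (_ & _) | _ , inj₁ ()
... | just (_ & _) | _ , inj₂ ()
... | just (_ ⊕ _) | _ , inj₁ ()
... | just (_ ⊕ _) | _ , inj₂ ()
... | nothing      | _ , inj₁ ()
... | nothing      | _ , inj₂ ()

gv-additive : ∀ Γ j {D} r → nth Γ j ≡ just D → Additive (sub D r)
  → IsWith (cutFree Γ) (gv j r) ⊎ IsPlus (cutFree Γ) (gv j r)
gv-additive Γ j {D} r eq add rewrite eq with sub D r | add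
... | _ | with′ = inj₁ (_ , _ , refl)
... | _ | plus′ = inj₂ (_ , _ , refl)

leaf-two : ∀ X Y a → IsLeaf (cutFree (X ∷ Y ∷ [])) a
  → (Σ Path λ p → a ≡ gv 0 p) ⊎ (Σ Path λ p → a ≡ gv 1 p)
leaf-two _ _ (gv 0 p) _ = inj₁ (p , refl)
leaf-two _ _ (gv 1 p) _ = inj₂ (p , refl)
leaf-two _ _ (gv (suc (suc _)) p) (_ , inj₁ ())
leaf-two _ _ (gv (suc (suc _)) p) (_ , inj₂ ())
leaf-two _ _ (cv _) (_ , inj₁ ())
leaf-two _ _ (cv _) (_ , inj₂ ())
leaf-two _ _ (cl _ _) (_ , inj₁ ())
leaf-two _ _ (cl _ _) (_ , inj₂ ())
leaf-two _ _ (cr _ _) (_ , inj₁ ())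
leaf-two _ _ (cr _ _) (_ , inj₂ ())

≼-++ : ∀ {a j} r s → a ≼ gv j r → a ≼ gv j (r ++ s)
≼-++ r []      a≼ = subst (λ p → _ ≼ gv _ p) (sym (++-identityʳ r)) a≼
≼-++ r (d ∷ s) a≼ =
  subst (λ p → _ ≼ gv _ p) (++-assoc r (d ∷ []) s) (≼-++ (r ++ d ∷ []) s (≼-child {d = d} a≼))

child-≼ : ∀ j r d s → child (gv j r) d ≼ gv j (r ++ d ∷ s)
child-≼ j r d s = subst (λ p → _ ≼ gv j p) (++-assoc r (d ∷ []) s) (≼-++ (r ++ d ∷ []) s ≼-refl)

-- The additive resolution of the sequent, restricted to one conclusion: a single choice that all
-- leaves of `λ'` in this conclusion follow.
resolution : ∀ {Γ λ' j D} → nth Γ j ≡ just D → IsLinking (cutFree Γ) λ'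
  → Σ (Path → Dir) λ c → ∀ p → LeafOf λ' (gv j p) → OnResolution c D p
resolution {Γ} {j = j} eq lk@(_ , _ , _ , c , res) = c ∘ gv j , λ p l →
  let leaf        = leaf-label lk l
      _ , _ , fol = proj₂ (res (gv j p) leaf) l
  in gv-atomic Γ j p eq leaf
   , λ { r d s refl add → fol (gv j r) d (gv-additive Γ j r eq add) (child-≼ j r d s) }

-- Composition of nets with two conclusions

-- The renamings are local to `compose`; their values on the two conclusions of each net are all
-- that is used of them.
record Glue (f g : Addr → Addr) : Set where
  field
    f₀ : ∀ p → f (gv 0 p) ≡ gv 0 p
    f₁ : ∀ p → f (gv 1 p) ≡ cl 0 p
    g₀ : ∀ p → g (gv 0 p) ≡ cr 0 p
    g₁ : ∀ p → g (gv 1 p) ≡ gv 1 p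

pairing : (f g : Addr → Addr) → Net → Net → Net
pairing f g θ ψ = concatMap (λ λ' → map (λ μ → mapLinking f λ' ++ mapLinking g μ) ψ) θ

compose₂ : Fm → Fm → Fm → Net → Net → State
compose₂ X C Y θ ψ = compose (X ∷ []) C [] θ [] (Y ∷ []) ψ

compose-pairing : ∀ X C Y θ ψ → Σ (Addr → Addr) λ f → Σ (Addr → Addr) λ g →
  Glue f g × proj₂ (compose₂ X C Y θ ψ) ≡ pairing f g θ ψ
compose-pairing X C Y θ ψ = _ , _ , record
  { f₀ = λ _ → refl ; f₁ = λ _ → refl ; g₀ = λ _ → refl ; g₁ = λ _ → refl } , refl

data Origin (λ' μ : Linking) : Addr → Set where
  from₀ : ∀ {p} → LeafOf λ' (gv 0 p) → Origin λ' μ (gv 0 p)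
  fromˡ : ∀ {p} → LeafOf λ' (gv 1 p) → Origin λ' μ (cl 0 p)
  fromʳ : ∀ {p} → LeafOf μ  (gv 0 p) → Origin λ' μ (cr 0 p)
  from₁ : ∀ {p} → LeafOf μ  (gv 1 p) → Origin λ' μ (gv 1 p)

module _ {f g : Addr → Addr} (glue : Glue f g) {X C Y : Fm} {λ' μ : Linking}
  (lkλ : IsLinking (cutFree (X ∷ C ∷ [])) λ') (lkμ : IsLinking (cutFree (dual C ∷ Y ∷ [])) μ) where

  open Glue glue

  union-leaf⁻ : ∀ {a} → LeafOf (mapLinking f λ' ++ mapLinking g μ) a → Origin λ' μ a
  union-leaf⁻ l with leaf-++⁻ (mapLinking f λ') l
  union-leaf⁻ l | inj₁ lf with leaf-map⁻ f lf
  ... | a , la , refl with leaf-two X C a (leaf-label lkλ la)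
  ... | inj₁ (p , refl) = subst (Origin λ' μ) (sym (f₀ p)) (from₀ la)
  ... | inj₂ (p , refl) = subst (Origin λ' μ) (sym (f₁ p)) (fromˡ la)
  union-leaf⁻ l | inj₂ lg with leaf-map⁻ g lg
  ... | a , la , refl with leaf-two (dual C) Y a (leaf-label lkμ la)
  ... | inj₁ (p , refl) = subst (Origin λ' μ) (sym (g₀ p)) (fromʳ la)
  ... | inj₂ (p , refl) = subst (Origin λ' μ) (sym (g₁ p)) (from₁ la)

  union-coherent : (∀ p q → LeafOf λ' (gv 1 p) → LeafOf μ (gv 0 q) → Coh C p (flip q))
    → Coherent (C ∷ []) (mapLinking f λ' ++ mapLinking g μ)
  union-coherent cohC .inTreeˡ k d p l with union-leaf⁻ l
  ... | fromˡ lλ = C , refl , atomic≢nothing (proj₁ (proj₂ (resolution refl lkλ) _ lλ))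
  union-coherent cohC .inTreeʳ k d p l with union-leaf⁻ l
  ... | fromʳ lμ = C , refl ,
        atomic≢nothing (proj₁ (onResolution-undual (d ∷ p) (proj₂ (resolution refl lkμ) _ lμ)))
  union-coherent cohC .coh k D d p e q eq l l′ with union-leaf⁻ l | union-leaf⁻ l′ | eq
  ... | fromˡ lλ | fromʳ lμ | refl = cohC _ _ lλ lμ

module _ {X C Y A : Fm} {S : Seq} {θ ψ : Net}
  (lkθ : All (IsLinking (cutFree (X ∷ C ∷ []))) θ)
  (lkψ : All (IsLinking (cutFree (dual C ∷ Y ∷ []))) ψ)
  (red : ReducesTo (compose₂ X C Y θ ψ) (S , idNet A)) where

  private
    steps : compose₂ X C Y θ ψ ⟶* proj₁ red
    steps = proj₁ (proj₂ red)

    reduct≈id : proj₂ (proj₁ red) ≈N idNet A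
    reduct≈id = proj₂ (proj₂ (proj₂ red))

  -- The linking of the identity on the resolution `c` is traced back to a union of `λ'` and `μ`.
  -- Its leaves in conclusion 0 can only stem from `λ'`, those in conclusion 1 only from `μ`.
  reduct-covers : ∀ c → Σ Linking λ λ' → Σ Linking λ μ → λ' ∈ θ × μ ∈ ψ ×
    (∀ p → OnResolution c A p → LeafOf μ (gv 1 p) × LeafOf λ' (gv 0 (flip p)))
  reduct-covers c with idNet-covers A c | compose-pairing X C Y θ ψ
  ... | ι , ι∈ , cov | f , g , glue , eq with proj₂ reduct≈id ι ι∈
  ... | ν , ν∈ , ν≈ι with originates steps (ν , ν∈ , λ j p l → l)
  ... | ρ , ρ∈ , ν⊑ρ with ∈-pairs⁻ (λ λ' μ → mapLinking f λ' ++ mapLinking g μ) θ ψ (subst (ρ ∈_) eq ρ∈)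
  ... | λ' , μ , λ∈ , μ∈ , refl = λ' , μ , λ∈ , μ∈ , λ p on →
        in-μ (back (proj₁ (cov p on))) , in-λ (back (proj₂ (cov p on)))
    where
    back : ∀ {j p} → LeafOf ι (gv j p) → Origin λ' μ (gv j p)
    back l = union-leaf⁻ glue (lookupAll lkθ λ∈) (lookupAll lkψ μ∈)
               (ν⊑ρ _ _ (leaf-⊆ (λ {ℓ} → proj₂ (ν≈ι ℓ)) l))

    in-λ : ∀ {p} → Origin λ' μ (gv 0 p) → LeafOf λ' (gv 0 p)
    in-λ (from₀ l) = l

    in-μ : ∀ {p} → Origin λ' μ (gv 1 p) → LeafOf μ (gv 1 p)
    in-μ (from₁ l) = l

  module _ {λ' μ : Linking} (λ∈ : λ' ∈ θ) (μ∈ : μ ∈ ψ)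
    (cohC : ∀ p q → LeafOf λ' (gv 1 p) → LeafOf μ (gv 0 q) → Coh C p (flip q)) where

    private
      -- The union of `λ'` and `μ` is coherent by `cohC`, hence survives the reduction and ends as a
      -- linking of the identity that still has its links between conclusions.
      ρ⊴ι : Σ Linking λ ι → ι ∈ idNet A
        × (∀ p q → (gv 0 p , gv 0 q) ∈ λ' → (gv 0 p , gv 0 q) ∈ ι)
        × (∀ p q → (gv 1 p , gv 1 q) ∈ μ → (gv 1 p , gv 1 q) ∈ ι)
      ρ⊴ι with compose-pairing X C Y θ ψ
      ... | f , g , glue , eq
        with survives _ steps
               (subst (mapLinking f λ' ++ mapLinking g μ ∈_) (sym eq)
                 (∈-pairs⁺ (λ λ' μ → mapLinking f λ' ++ mapLinking g μ) λ∈ μ∈))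
               (union-coherent glue (lookupAll lkθ λ∈) (lookupAll lkψ μ∈) cohC)
      ... | ν , ν∈ , _ , keep with proj₁ reduct≈id ν ν∈
      ... | ι , ι∈ , ν≈ι = ι , ι∈
          , (λ p q ℓ∈ → proj₁ (ν≈ι _) (keep (∈-++⁺ˡ
              (subst₂ (λ a b → (a , b) ∈ mapLinking f λ') (f₀ p) (f₀ q) (∈-map⁺ _ ℓ∈)))))
          , (λ p q ℓ∈ → proj₁ (ν≈ι _) (keep (∈-++⁺ʳ (mapLinking f λ')
              (subst₂ (λ a b → (a , b) ∈ mapLinking g μ) (g₁ p) (g₁ q) (∈-map⁺ _ ℓ∈)))))
        where open Glue glue

    no-link₀₀ : ∀ p q → ¬ ((gv 0 p , gv 0 q) ∈ λ')
    no-link₀₀ p q ℓ∈ with ρ⊴ι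
    ... | ι , ι∈ , in₀ , _ with bipartite-idNet A ι ι∈ _ (in₀ p q ℓ∈)
    ... | inj₁ (_ , ())
    ... | inj₂ (() , _)

    no-link₁₁ : ∀ p q → ¬ ((gv 1 p , gv 1 q) ∈ μ)
    no-link₁₁ p q ℓ∈ with ρ⊴ι
    ... | ι , ι∈ , _ , in₁ with bipartite-idNet A ι ι∈ _ (in₁ p q ℓ∈)
    ... | inj₁ (() , _)
    ... | inj₂ (_ , ())

-- Mutually inverse nets

module _ {A B : Fm} {θ θ' : Net}
  (lkθ : All (IsLinking (cutFree (dual A ∷ B ∷ []))) θ)
  (lkθ' : All (IsLinking (cutFree (dual B ∷ A ∷ []))) θ')
  (redA : ReducesTo (compose₂ (dual A) B A θ θ') (cutFree (dual A ∷ A ∷ []) , idNet A))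
  (redB : ReducesTo (compose₂ (dual B) A B θ' θ) (cutFree (dual B ∷ B ∷ []) , idNet B)) where

  -- The partner μ of λ' is read off the identity of B at the resolution of B used by λ'.
  no-link-A⊥ : ∀ {λ'} → λ' ∈ θ → ∀ p q → ¬ ((gv 0 p , gv 0 q) ∈ λ')
  no-link-A⊥ λ∈ with resolution refl (lookupAll lkθ λ∈)
  ... | c , onB with reduct-covers lkθ' lkθ redB c
  ... | μ , _ , μ∈ , _ , cov = no-link₀₀ {A = A} lkθ lkθ' redA λ∈ μ∈ λ p q lp lq →
    -- By covering, `flip p` is a leaf of `μ`. Hence `flip p` and `q` lie on the one resolution of
    -- `dual B` used by `μ`, and their coherence there is carried over to `B`.
    let _ , onB⊥ = resolution refl (lookupAll lkθ' μ∈)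
    in coh-undual p q (follows⇒coh
         (proj₂ (onB⊥ (flip p) (proj₂ (cov p (onB p lp))))) (proj₂ (onB⊥ q lq)))

  -- The partner `μ` is now found through the identity of `A`, whose resolutions are given by paths
  -- of `A`; the choice made by `λ'` on `dual A` is therefore dualised first.
  no-link-B : ∀ {λ'} → λ' ∈ θ → ∀ p q → ¬ ((gv 1 p , gv 1 q) ∈ λ')
  no-link-B λ∈ with resolution refl (lookupAll lkθ λ∈)
  ... | c , onA⊥ with reduct-covers lkθ lkθ' redA (dualChoice c)
  ... | _ , μ , _ , μ∈ , cov = no-link₁₁ {A = B} lkθ' lkθ redB μ∈ λ∈ λ p q lp lq →
    let _ , onA = resolution refl (lookupAll lkθ' μ∈)
    in follows⇒coh (proj₂ (onA p lp))
         (proj₂ (onA (flip q) (proj₁ (cov (flip q) (onResolution-undual q (onA⊥ q lq))))))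

  bipartite : Bipartite θ
  bipartite λ' λ∈ (a , b) ℓ∈
    with leaf-two (dual A) B a (leaf-label (lookupAll lkθ λ∈) (leaf₁ ℓ∈))
       | leaf-two (dual A) B b (leaf-label (lookupAll lkθ λ∈) (leaf₂ ℓ∈))
  ... | inj₁ (p , refl) | inj₁ (q , refl) = ⊥-elim (no-link-A⊥ λ∈ p q ℓ∈)
  ... | inj₁ (p , refl) | inj₂ (q , refl) = inj₁ (refl , refl)
  ... | inj₂ (p , refl) | inj₁ (q , refl) = inj₂ (refl , refl)
  ... | inj₂ (p , refl) | inj₂ (q , refl) = ⊥-elim (no-link-B λ∈ p q ℓ∈)

  full : Full (cutFree (dual A ∷ B ∷ [])) θ
  full a leaf with leaf-two (dual A) B a leaf
  -- The choice `along p` gives a resolution containing this leaf. Conclusion `B` of the composition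
  -- over `A` belongs to `θ`, so the linking traced back from the identity of `B` has the leaf.
  ... | inj₂ (p , refl) with reduct-covers lkθ' lkθ redB (along p)
  ...   | _ , λ' , _ , λ∈ , cov =
          λ' , λ∈ , proj₁ (cov p (gv-atomic (dual A ∷ B ∷ []) 1 p refl leaf , follows-along B p))
  -- A leaf `q` of `dual A` is covered as the partner of the leaf `flip q` of `A`.
  full a leaf | inj₁ (q , refl) with reduct-covers lkθ lkθ' redA (dualChoice (along q))
  ... | λ' , _ , λ∈ , _ , cov = λ' , λ∈ ,
        subst (λ r → LeafOf λ' (gv 0 r)) (flip-involutive q) (proj₂ (cov (flip q) (onResolution-undual q
          (gv-atomic (dual A ∷ B ∷ []) 0 q refl leaf , follows-along (dual A) q))))

theorem8p11 : ∀ (A B : Fm) (θ θ' : Net)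
    → IsProofNet (cutFree (dual A ∷ B ∷ [])) θ
    → IsProofNet (cutFree (dual B ∷ A ∷ [])) θ'
    → ReducesTo (compose (dual A ∷ []) B [] θ [] (A ∷ []) θ')
    (cutFree (dual A ∷ A ∷ []) , idNet A)
    → ReducesTo (compose (dual B ∷ []) A [] θ' [] (B ∷ []) θ)
    (cutFree (dual B ∷ B ∷ []) , idNet B)
    → (Bipartite θ × Full (cutFree (dual A ∷ B ∷ [])) θ)
    × (Bipartite θ' × Full (cutFree (dual B ∷ A ∷ [])) θ')
theorem8p11 A B θ θ' net net' redA redB =
    (bipartite lkθ lkθ' redA redB , full lkθ lkθ' redA redB)
  -- The assumptions are symmetric under exchanging `A` with `B` and `θ` with `θ'`.
  , (bipartite lkθ' lkθ redB redA , full lkθ' lkθ redB redA)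
  where
  lkθ  = IsProofNet.linkings net
  lkθ' = IsProofNet.linkings net'
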